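{- Let $k\geq 2$ be an even integer, and let $G$ be a connected graph of order $$n\geq\frac{2k+3+\sqrt{8k^{2}-8k+1}}{2}.$$ If $$q(G)>2(n-2)+\frac{2k-2}{n-1},$$ then $G$ has the $k$-strong parity property.
   Context: All graphs are finite, undirected and simple. For a graph $G$, $V(G)$ is its vertex set, its order is $n=|V(G)|$, and $d_G(v)$ is the degree of the vertex $v$ in $G$. The signless Laplacian matrix of $G$ is $Q(G)=D(G)+A(G)$, where $A(G)$ is the adjacency matrix of $G$ and $D(G)$ is the diagonal matrix of vertex degrees of $G$. The signless Laplacian spectral radius $q(G)$ is the largest eigenvalue of $Q(G)$. For an even integer $k\geq 2$, a graph $G$ has the $k$-strong parity property if for every $X\subseteq V(G)$ with $|X|$ even, $G$ contains a spanning subgraph $F$ (a subgraph with $V(F)=V(G)$) such that $d_F(u)\equiv 1 \pmod 2$ for each $u\in X$ and $d_F(v)\in\{k,k+2,k+4,\ldots\}$ for each $v\in V(G)\setminus X$. -}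

module Defs where

open import Data.Bool using (Bool; true; false; if_then_else_)
open import Data.Fin using (Fin)
import Data.Fin.Properties as Fin
open import Data.Fin.Subset using (Subset; ∣_∣; _∈_; _∉_)
open import Data.Integer as ℤ using (ℤ; +_)
open import Data.Nat as ℕ using (ℕ; zero; suc)
import Data.Nat.Properties as ℕ
open import Data.Nat.Divisibility using (_∣_)
open import Data.Product using (∃-syntax; Σ-syntax; _×_; _,_)
open import Data.Rational as ℚ using (ℚ; 0ℚ; 1ℚ; ½)
import Data.Rational.Properties as ℚ
open import Data.Rational.Solver using (module +-*-Solver)
open import Data.Vec using (tabulate)
open import Data.Vec.Functional using (foldr)
open import Relation.Binary.Construct.Closure.ReflexiveTransitive using (Star)
open import Relation.Binary.PropositionalEquality
  using (_≡_; refl; sym; trans; cong; subst)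
open import Relation.Nullary using (¬_)
open import Relation.Nullary.Decidable using (⌊_⌋)

-- Real numbers: Cauchy sequences of rationals with a modulus of
-- convergence, up to the equivalence _≈ᴿ_.

Eventually : (ℕ → Set) → Set
Eventually P = ∃[ N ] (∀ n → N ℕ.≤ n → P n)

IsCauchy : (ℕ → ℚ) → Set
IsCauchy x = ∀ ε → 0ℚ ℚ.< ε →
  ∃[ N ] (∀ m n → N ℕ.≤ m → N ℕ.≤ n → ℚ.∣ x m ℚ.- x n ∣ ℚ.< ε)

record ℝ : Set where
  constructor mkℝ
  field
    seq    : ℕ → ℚ
    cauchy : IsCauchy seq

open ℝ public

infix  4 _≈ᴿ_ _≤ᴿ_ _<ᴿ_
infixl 6 _+ᴿ_
infixl 7 _*ᴿ_

_≈ᴿ_ _≤ᴿ_ _<ᴿ_ : ℝ → ℝ → Set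
x ≈ᴿ y = ∀ ε → 0ℚ ℚ.< ε → Eventually λ n → ℚ.∣ seq x n ℚ.- seq y n ∣ ℚ.< ε
x ≤ᴿ y = ∀ ε → 0ℚ ℚ.< ε → Eventually λ n → seq x n ℚ.≤ seq y n ℚ.+ ε
x <ᴿ y = ∃[ ε ] (0ℚ ℚ.< ε × Eventually λ n → seq x n ℚ.+ ε ℚ.≤ seq y n)

fromℚ : ℚ → ℝ
fromℚ p = mkℝ (λ _ → p) λ ε 0<ε → 0 , λ _ _ _ _ →
  subst (λ r → ℚ.∣ r ∣ ℚ.< ε) (sym (ℚ.+-inverseʳ p)) 0<ε

fromℤ : ℤ → ℝ
fromℤ i = fromℚ (i ℚ./ 1)

fromℕ : ℕ → ℝ
fromℕ n = fromℤ (+ n)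

0ᴿ : ℝ
0ᴿ = fromℚ 0ℚ

half-pos : ∀ {ε} → 0ℚ ℚ.< ε → 0ℚ ℚ.< ½ ℚ.* ε
half-pos {ε} 0<ε = subst (ℚ._< ½ ℚ.* ε) (ℚ.*-zeroʳ ½) (ℚ.*-monoʳ-<-pos ½ 0<ε)

half+half : ∀ ε → ½ ℚ.* ε ℚ.+ ½ ℚ.* ε ≡ ε
half+half ε =
  trans (sym (ℚ.*-distribʳ-+ ε ½ ½)) (ℚ.*-identityˡ ε)

+-telescope : ∀ a b c d → (a ℚ.+ b) ℚ.- (c ℚ.+ d) ≡ (a ℚ.- c) ℚ.+ (b ℚ.- d)
+-telescope = solve 4 (λ a b c d → (a :+ b) :- (c :+ d) := (a :- c) :+ (b :- d)) refl
  where open +-*-Solver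

-+-telescope : ∀ a b → a ≡ (a ℚ.- b) ℚ.+ b
-+-telescope = solve 2 (λ a b → a := (a :- b) :+ b) refl
  where open +-*-Solver

*-telescope : ∀ a b c d →
  a ℚ.* b ℚ.- c ℚ.* d ≡ a ℚ.* (b ℚ.- d) ℚ.+ d ℚ.* (a ℚ.- c)
*-telescope =
  solve 4 (λ a b c d → a :* b :- c :* d := a :* (b :- d) :+ d :* (a :- c)) refl
  where open +-*-Solver

+-cauchy : ∀ {x y} → IsCauchy x → IsCauchy y → IsCauchy (λ n → x n ℚ.+ y n)
+-cauchy {x} {y} cx cy ε 0<ε with cx (½ ℚ.* ε) (half-pos 0<ε) | cy (½ ℚ.* ε) (half-pos 0<ε)
... | N , hx | M , hy = N ℕ.⊔ M , λ m n N≤m N≤n → begin-strict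
    ℚ.∣ (x m ℚ.+ y m) ℚ.- (x n ℚ.+ y n) ∣
  ≡⟨ cong ℚ.∣_∣ (+-telescope (x m) (y m) (x n) (y n)) ⟩
    ℚ.∣ (x m ℚ.- x n) ℚ.+ (y m ℚ.- y n) ∣
  ≤⟨ ℚ.∣p+q∣≤∣p∣+∣q∣ (x m ℚ.- x n) (y m ℚ.- y n) ⟩
    ℚ.∣ x m ℚ.- x n ∣ ℚ.+ ℚ.∣ y m ℚ.- y n ∣
  <⟨ ℚ.+-mono-< (hx m n (ℕ.m⊔n≤o⇒m≤o N M N≤m) (ℕ.m⊔n≤o⇒m≤o N M N≤n))
                (hy m n (ℕ.m⊔n≤o⇒n≤o N M N≤m) (ℕ.m⊔n≤o⇒n≤o N M N≤n)) ⟩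
    ½ ℚ.* ε ℚ.+ ½ ℚ.* ε
  ≡⟨ half+half ε ⟩
    ε
  ∎
  where open ℚ.≤-Reasoning

bounded : ∀ {x} → IsCauchy x →
          ∃[ B ] (0ℚ ℚ.< B × Eventually λ n → ℚ.∣ x n ∣ ℚ.≤ B)
bounded {x} cx with cx 1ℚ (ℚ.positive⁻¹ 1ℚ)
... | N , h = 1ℚ ℚ.+ ℚ.∣ x N ∣
            , ℚ.+-mono-<-≤ {0ℚ} {1ℚ} {0ℚ} {ℚ.∣ x N ∣} (ℚ.positive⁻¹ 1ℚ) (ℚ.0≤∣p∣ (x N))
            , N , λ n N≤n → begin
    ℚ.∣ x n ∣
  ≡⟨ cong ℚ.∣_∣ (-+-telescope (x n) (x N)) ⟩
    ℚ.∣ (x n ℚ.- x N) ℚ.+ x N ∣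
  ≤⟨ ℚ.∣p+q∣≤∣p∣+∣q∣ (x n ℚ.- x N) (x N) ⟩
    ℚ.∣ x n ℚ.- x N ∣ ℚ.+ ℚ.∣ x N ∣
  ≤⟨ ℚ.+-monoˡ-≤ ℚ.∣ x N ∣ (ℚ.<⇒≤ (h n N N≤n ℕ.≤-refl)) ⟩
    1ℚ ℚ.+ ℚ.∣ x N ∣
  ∎
  where open ℚ.≤-Reasoning

divide : ∀ {B ε} → 0ℚ ℚ.< B → 0ℚ ℚ.< ε → ∃[ δ ] (0ℚ ℚ.< δ × B ℚ.* δ ≡ ε)
divide {B} {ε} 0<B 0<ε = δ , 0<δ , B*δ≡ε
  where
  instance
    B-pos : ℚ.Positive B
    B-pos = ℚ.positive 0<B
    B-nonZero : ℚ.NonZero B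
    B-nonZero = ℚ.pos⇒nonZero B
    1/B-pos : ℚ.Positive (ℚ.1/ B)
    1/B-pos = ℚ.1/pos⇒pos B
  δ : ℚ
  δ = ℚ.1/ B ℚ.* ε
  0<δ : 0ℚ ℚ.< δ
  0<δ = subst (ℚ._< δ) (ℚ.*-zeroʳ (ℚ.1/ B)) (ℚ.*-monoʳ-<-pos (ℚ.1/ B) 0<ε)
  B*δ≡ε : B ℚ.* δ ≡ ε
  B*δ≡ε = trans (sym (ℚ.*-assoc B (ℚ.1/ B) ε))
         (trans (cong (ℚ._* ε) (ℚ.*-inverseʳ B)) (ℚ.*-identityˡ ε))

∣*∣< : ∀ {B δ ε} p q → 0ℚ ℚ.< B → B ℚ.* δ ≡ ε →
      ℚ.∣ p ∣ ℚ.≤ B → ℚ.∣ q ∣ ℚ.< δ → ℚ.∣ p ℚ.* q ∣ ℚ.< ε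
∣*∣< {B} {δ} {ε} p q 0<B Bδ≡ε p≤B q<δ = begin-strict
    ℚ.∣ p ℚ.* q ∣
  ≡⟨ ℚ.∣p*q∣≡∣p∣*∣q∣ p q ⟩
    ℚ.∣ p ∣ ℚ.* ℚ.∣ q ∣
  ≤⟨ ℚ.*-monoʳ-≤-nonNeg ℚ.∣ q ∣ {{ℚ.∣-∣-nonNeg q}} p≤B ⟩
    B ℚ.* ℚ.∣ q ∣
  <⟨ ℚ.*-monoʳ-<-pos B {{ℚ.positive 0<B}} q<δ ⟩
    B ℚ.* δ
  ≡⟨ Bδ≡ε ⟩
    ε
  ∎
  where open ℚ.≤-Reasoning

*-step : ∀ {B C δ γ ε} a b c d → 0ℚ ℚ.< B → 0ℚ ℚ.< C →
  B ℚ.* δ ≡ ½ ℚ.* ε → C ℚ.* γ ≡ ½ ℚ.* ε → ℚ.∣ a ∣ ℚ.≤ B → ℚ.∣ d ∣ ℚ.≤ C →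
  ℚ.∣ b ℚ.- d ∣ ℚ.< δ → ℚ.∣ a ℚ.- c ∣ ℚ.< γ → ℚ.∣ a ℚ.* b ℚ.- c ℚ.* d ∣ ℚ.< ε
*-step {ε = ε} a b c d 0<B 0<C Bδ≡ Cγ≡ a≤B d≤C b-d<δ a-c<γ = begin-strict
    ℚ.∣ a ℚ.* b ℚ.- c ℚ.* d ∣
  ≡⟨ cong ℚ.∣_∣ (*-telescope a b c d) ⟩
    ℚ.∣ a ℚ.* (b ℚ.- d) ℚ.+ d ℚ.* (a ℚ.- c) ∣
  ≤⟨ ℚ.∣p+q∣≤∣p∣+∣q∣ (a ℚ.* (b ℚ.- d)) (d ℚ.* (a ℚ.- c)) ⟩
    ℚ.∣ a ℚ.* (b ℚ.- d) ∣ ℚ.+ ℚ.∣ d ℚ.* (a ℚ.- c) ∣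
  <⟨ ℚ.+-mono-< (∣*∣< a (b ℚ.- d) 0<B Bδ≡ a≤B b-d<δ)
                (∣*∣< d (a ℚ.- c) 0<C Cγ≡ d≤C a-c<γ) ⟩
    ½ ℚ.* ε ℚ.+ ½ ℚ.* ε
  ≡⟨ half+half ε ⟩
    ε
  ∎
  where open ℚ.≤-Reasoning

*-cauchy : ∀ {x y} → IsCauchy x → IsCauchy y → IsCauchy (λ n → x n ℚ.* y n)
*-cauchy {x} {y} cx cy ε 0<ε =
  let B , 0<B , N₁ , x≤B = bounded cx
      C , 0<C , N₂ , y≤C = bounded cy
      δ , 0<δ , Bδ≡ = divide 0<B (half-pos 0<ε)
      γ , 0<γ , Cγ≡ = divide 0<C (half-pos 0<ε)
      N₃ , hy = cy δ 0<δ
      N₄ , hx = cx γ 0<γ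
  in (N₁ ℕ.⊔ N₂) ℕ.⊔ (N₃ ℕ.⊔ N₄) , λ m n N≤m N≤n →
    let N₁₂≤m = ℕ.m⊔n≤o⇒m≤o (N₁ ℕ.⊔ N₂) (N₃ ℕ.⊔ N₄) N≤m
        N₁₂≤n = ℕ.m⊔n≤o⇒m≤o (N₁ ℕ.⊔ N₂) (N₃ ℕ.⊔ N₄) N≤n
        N₃₄≤m = ℕ.m⊔n≤o⇒n≤o (N₁ ℕ.⊔ N₂) (N₃ ℕ.⊔ N₄) N≤m
        N₃₄≤n = ℕ.m⊔n≤o⇒n≤o (N₁ ℕ.⊔ N₂) (N₃ ℕ.⊔ N₄) N≤n
    in *-step (x m) (y m) (x n) (y n) 0<B 0<C Bδ≡ Cγ≡
         (x≤B m (ℕ.m⊔n≤o⇒m≤o N₁ N₂ N₁₂≤m)) (y≤C n (ℕ.m⊔n≤o⇒n≤o N₁ N₂ N₁₂≤n))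
         (hy m n (ℕ.m⊔n≤o⇒m≤o N₃ N₄ N₃₄≤m) (ℕ.m⊔n≤o⇒m≤o N₃ N₄ N₃₄≤n))
         (hx m n (ℕ.m⊔n≤o⇒n≤o N₃ N₄ N₃₄≤m) (ℕ.m⊔n≤o⇒n≤o N₃ N₄ N₃₄≤n))

_+ᴿ_ _*ᴿ_ : ℝ → ℝ → ℝ
x +ᴿ y = mkℝ (λ n → seq x n ℚ.+ seq y n) (+-cauchy {seq x} {seq y} (cauchy x) (cauchy y))
x *ᴿ y = mkℝ (λ n → seq x n ℚ.* seq y n) (*-cauchy {seq x} {seq y} (cauchy x) (cauchy y))

IsSqrt : ℝ → ℝ → Set
IsSqrt x s = 0ᴿ ≤ᴿ s × s *ᴿ s ≈ᴿ x

-- Total division of an integer by a natural number, with the junk value 0 for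
-- a zero denominator.
infixl 7 _/₀_

_/₀_ : ℤ → ℕ → ℚ
i /₀ zero  = 0ℚ
i /₀ suc d = i ℚ./ suc d

Matrix : Set → ℕ → Set
Matrix A n = Fin n → Fin n → A

sumᴿ : ∀ {n} → (Fin n → ℝ) → ℝ
sumᴿ = foldr _+ᴿ_ 0ᴿ

IsEigenvalue : ∀ {n} → Matrix ℝ n → ℝ → Set
IsEigenvalue {n} M μ = Σ[ x ∈ (Fin n → ℝ) ]
  (¬ (∀ i → x i ≈ᴿ 0ᴿ) × (∀ i → sumᴿ (λ j → M i j *ᴿ x j) ≈ᴿ μ *ᴿ x i))

IsLargestEigenvalue : ∀ {n} → Matrix ℝ n → ℝ → Set
IsLargestEigenvalue M q = IsEigenvalue M q × (∀ μ → IsEigenvalue M μ → μ ≤ᴿ q)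

record Graph (n : ℕ) : Set where
  field
    adj        : Fin n → Fin n → Bool
    adj-sym    : ∀ u v → adj u v ≡ adj v u
    adj-irrefl : ∀ v → adj v v ≡ false

open Graph public

module _ {n : ℕ} (G : Graph n) where

  Adjacent : Fin n → Fin n → Set
  Adjacent u v = adj G u v ≡ true

  neighbours : Fin n → Subset n
  neighbours v = tabulate (adj G v)

  degree : Fin n → ℕ
  degree v = ∣ neighbours v ∣

  Connected : Set
  Connected = ∀ u v → Star Adjacent u v

  adjacencyMatrix : Matrix ℕ n
  adjacencyMatrix u v = if adj G u v then 1 else 0

  degreeMatrix : Matrix ℕ n
  degreeMatrix u v = if ⌊ u Fin.≟ v ⌋ then degree u else 0

  signlessLaplacian : Matrix ℕ n
  signlessLaplacian u v = degreeMatrix u v ℕ.+ adjacencyMatrix u v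

  -- q(G) = q.  The eigenvalues of the real symmetric matrix Q(G) are all real,
  -- so only real ones are compared.
  IsSignlessLaplacianSpectralRadius : ℝ → Set
  IsSignlessLaplacianSpectralRadius =
    IsLargestEigenvalue (λ u v → fromℕ (signlessLaplacian u v))

IsSpanningSubgraph : ∀ {n} → Graph n → Graph n → Set
IsSpanningSubgraph F G = ∀ u v → Adjacent F u v → Adjacent G u v

StrongParityProperty : ∀ {n} → ℕ → Graph n → Set
StrongParityProperty {n} k G = ∀ (X : Subset n) → 2 ∣ ∣ X ∣ →
  Σ[ F ∈ Graph n ] (IsSpanningSubgraph F G
    × (∀ u → u ∈ X → degree F u ℕ.% 2 ≡ 1)
    × (∀ v → v ∉ X → ∃[ j ] degree F v ≡ k ℕ.+ 2 ℕ.* j))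

{-# OPTIONS --safe #-}
module Submission where

-- Weighting the rows of Q by the degrees, an entry of an eigenvector x where |x_v| / d_v is
-- maximal gives q(G) ≤ n - 2 + 2e / (n - 1), so the hypothesis on q(G) forces
-- 2e > (n - 1)(n - 2) + 2k - 2: fewer than n - k pairs are non-adjacent, and every degree is
-- at least k.  Given X, let T be the (even) set of vertices whose degree in G has the wrong
-- parity.  If G[T] has a perfect matching, deleting it yields F.  Otherwise at least |T| - 1
-- pairs inside T are non-adjacent, which leaves so few other non-adjacent pairs that some
-- h ∉ T is adjacent to all of T and has degree at least k + |T| - 1; deleting the star from h
-- to T yields F.

open import Defs

-- The order on Cauchy reals is undecidable, so an entry of a real vector with |x_v| / d_v maximal
-- cannot be selected. The maximum is taken instead among the rational approximations at a single
-- index, where Qx = qx holds only up to an error η. The strict inequality on q supplies a fixed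
-- rational gap ε above the bound, so every approximate entry is at most η d_v / ε; letting η shrink
-- makes all of x vanish, which an eigenvector may not do.
--
-- The number |T| - 1 arises from a pairing of T with a non-edge uv that cannot be improved: uv is
-- one missing pair, and each of the other |T| / 2 - 1 pairs misses at least two of its four
-- connections to u and v.
--
-- Both deletions guarantee only degree at least k - 1 in F. Outside X that is enough, since there
-- the degree is even and so is k.

module Sums where

  open import Data.Bool using (Bool; true; false; not; if_then_else_; _xor_)
  open import Data.Bool.Properties using (not-involutive)
  open import Data.Empty using (⊥-elim)
  open import Data.Fin using (Fin; zero; suc; _≟_)
  open import Data.List using (List; []; _∷_; _++_; map; length; allFin; filterᵇ)
  open import Data.List.Properties using (map-++; map-tabulate)
  open import Data.List.Membership.Propositional using (_∈_)
  open import Data.List.Relation.Binary.Permutation.Propositional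
    using (_↭_; ↭-refl; ↭-prep; ↭-sym; ↭-trans)
  open import Data.List.Relation.Binary.Permutation.Propositional.Properties
    using (shift) renaming (map⁺ to ↭-map⁺)
  open import Data.List.Relation.Unary.Any using (here; there)
  open import Data.Nat hiding (_≟_)
  open import Data.Nat.ListAction using (sum)
  open import Data.Nat.ListAction.Properties using (sum-++; sum-↭)
  open import Data.Nat.Properties hiding (_≟_)
  open import Data.Nat.Tactic.RingSolver using (solve-∀)
  open import Data.Product using (∃-syntax; _,_)
  open import Function using (id; _∘_)
  open import Relation.Binary.PropositionalEquality
  open import Relation.Nullary using (yes; no)
  open import Relation.Nullary.Decidable using (⌊_⌋)

  -- Finite sums over lists, double sums, Kronecker delta and parity.

  𝟙 : Bool → ℕ
  𝟙 b = if b then 1 else 0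

  ∑ : {A : Set} → List A → (A → ℕ) → ℕ
  ∑ l f = sum (map f l)

  interchange : ∀ a b c d → (a + b) + (c + d) ≡ (a + c) + (b + d)
  interchange = solve-∀

  module _ {A : Set} where

    ∑-cong : ∀ (l : List A) {f g} → (∀ x → f x ≡ g x) → ∑ l f ≡ ∑ l g
    ∑-cong []      e = refl
    ∑-cong (x ∷ l) e = cong₂ _+_ (e x) (∑-cong l e)

    ∑-mono : ∀ (l : List A) {f g} → (∀ x → f x ≤ g x) → ∑ l f ≤ ∑ l g
    ∑-mono []      e = z≤n
    ∑-mono (x ∷ l) e = +-mono-≤ (e x) (∑-mono l e)

    ∑-+ : ∀ (l : List A) f g → ∑ l (λ x → f x + g x) ≡ ∑ l f + ∑ l g
    ∑-+ []      f g = refl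
    ∑-+ (x ∷ l) f g = trans (cong (f x + g x +_) (∑-+ l f g)) (interchange (f x) _ _ _)

    ∑-*ʳ : ∀ (l : List A) f c → ∑ l (λ x → f x * c) ≡ ∑ l f * c
    ∑-*ʳ []      f c = refl
    ∑-*ʳ (x ∷ l) f c = trans (cong (f x * c +_) (∑-*ʳ l f c)) (sym (*-distribʳ-+ c (f x) _))

    ∑-const : ∀ (l : List A) c → ∑ l (λ _ → c) ≡ length l * c
    ∑-const []      c = refl
    ∑-const (x ∷ l) c = cong (c +_) (∑-const l c)

    length≤∑ : ∀ (l : List A) {f} → (∀ {x} → x ∈ l → 1 ≤ f x) → length l ≤ ∑ l f
    length≤∑ []      e = z≤n
    length≤∑ (x ∷ l) e = +-mono-≤ (e (here refl)) (length≤∑ l (e ∘ there))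

    ∑-++ : ∀ (l m : List A) f → ∑ (l ++ m) f ≡ ∑ l f + ∑ m f
    ∑-++ l m f = trans (cong sum (map-++ f l m)) (sum-++ (map f l) _)

    ∑-↭ : ∀ {l m : List A} f → l ↭ m → ∑ l f ≡ ∑ m f
    ∑-↭ f p = sum-↭ (↭-map⁺ f p)

    term≤∑ : ∀ {x} {l : List A} f → x ∈ l → f x ≤ ∑ l f
    term≤∑ f (here refl) = m≤m+n _ _
    term≤∑ {l = y ∷ l} f (there p) = ≤-trans (term≤∑ f p) (m≤n+m _ (f y))

    ∑-filter : ∀ p (l : List A) f → ∑ (filterᵇ p l) f ≡ ∑ l (λ x → 𝟙 (p x) * f x)
    ∑-filter p []      f = refl
    ∑-filter p (x ∷ l) f with p x
    ... | true  = cong₂ _+_ (sym (+-identityʳ (f x))) (∑-filter p l f)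
    ... | false = ∑-filter p l f

    ↭-filter : ∀ p (l : List A) → l ↭ filterᵇ p l ++ filterᵇ (not ∘ p) l
    ↭-filter p []      = ↭-refl
    ↭-filter p (x ∷ l) with p x
    ... | true  = ↭-prep x (↭-filter p l)
    ... | false = ↭-trans (↭-prep x (↭-filter p l)) (↭-sym (shift x (filterᵇ p l) _))

  ∑∑ : {A : Set} → List A → List A → (A → A → ℕ) → ℕ
  ∑∑ l m f = ∑ l (λ x → ∑ m (f x))

  -- For symmetric f, the sum over l × l splits along l = x ∷ m and l = m ++ m′.
  module Square {A : Set} (f : A → A → ℕ) (f-sym : ∀ x y → f x y ≡ f y x) where

    □ : List A → ℕ
    □ l = ∑∑ l l f

    ∑∑-swap : ∀ l m → ∑∑ l m f ≡ ∑∑ m l f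
    ∑∑-swap []      m = sym (trans (∑-const m 0) (*-zeroʳ (length m)))
    ∑∑-swap (x ∷ l) m = trans
      (cong₂ _+_ (∑-cong m (f-sym x)) (∑∑-swap l m))
      (sym (∑-+ m (λ y → f y x) _))

    □-∷ : ∀ x l → □ (x ∷ l) ≡ f x x + 2 * ∑ l (f x) + □ l
    □-∷ x l = begin
        f x x + ∑ l (f x) + ∑ l (λ y → f y x + ∑ l (f y))
      ≡⟨ cong (f x x + ∑ l (f x) +_) (∑-+ l (λ y → f y x) _) ⟩
        f x x + ∑ l (f x) + (∑ l (λ y → f y x) + □ l)
      ≡⟨ cong (λ s → f x x + ∑ l (f x) + (s + □ l)) (∑-cong l (λ y → f-sym y x)) ⟩
        f x x + ∑ l (f x) + (∑ l (f x) + □ l)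
      ≡⟨ rearrange (f x x) (∑ l (f x)) (□ l) ⟩
        f x x + 2 * ∑ l (f x) + □ l
      ∎
      where
      open ≡-Reasoning
      rearrange : ∀ a b c → a + b + (b + c) ≡ a + 2 * b + c
      rearrange = solve-∀

    □-++ : ∀ l m → □ (l ++ m) ≡ □ l + □ m + 2 * ∑∑ l m f
    □-++ []      m = sym (+-identityʳ (□ m))
    □-++ (x ∷ l) m rewrite □-∷ x (l ++ m) | □-∷ x l | □-++ l m | ∑-++ l m (f x) =
      rearrange (f x x) (∑ l (f x)) (∑ m (f x)) (□ l) (□ m) (∑∑ l m f)
      where
      rearrange : ∀ a b c d e g →
        a + 2 * (b + c) + (d + e + 2 * g) ≡ a + 2 * b + d + e + 2 * (c + g)
      rearrange = solve-∀

    □-↭ : ∀ {l m} → l ↭ m → □ l ≡ □ m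
    □-↭ {l} {m} p = trans (∑-↭ _ p) (∑-cong m (λ x → ∑-↭ (f x) p))

    -- The diagonal alone contributes this much. Applied to non-adjacency, this is the estimate that
    -- ignores every missing pair inside `l`.
    length≤□ : (∀ x → 1 ≤ f x x) → ∀ l → length l ≤ □ l
    length≤□ e []      = z≤n
    length≤□ e (x ∷ l) rewrite □-∷ x l =
      +-mono-≤ (≤-trans (e x) (m≤m+n _ _)) (length≤□ e l)

  δ : ∀ {n} → Fin n → Fin n → ℕ
  δ x y = 𝟙 ⌊ x ≟ y ⌋

  δ-refl : ∀ {n} (x : Fin n) → δ x x ≡ 1
  δ-refl x with x ≟ x
  ... | yes _ = refl
  ... | no ¬e = ⊥-elim (¬e refl)

  δ-≢ : ∀ {n} {x y : Fin n} → x ≢ y → δ x y ≡ 0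
  δ-≢ {x = x} {y} x≢y with x ≟ y
  ... | yes e = ⊥-elim (x≢y e)
  ... | no _  = refl

  δ-suc : ∀ {n} (x y : Fin n) → δ (suc x) (suc y) ≡ δ x y
  δ-suc x y with x ≟ y
  ... | yes _ = refl
  ... | no _  = refl

  δ-sym : ∀ {n} (x y : Fin n) → δ x y ≡ δ y x
  δ-sym x y with x ≟ y
  ... | yes refl = sym (δ-refl x)
  ... | no ¬e    = sym (δ-≢ (¬e ∘ sym))

  ∑-allFin-suc : ∀ {n} (f : Fin (suc n) → ℕ) →
    ∑ (allFin (suc n)) f ≡ f zero + ∑ (allFin n) (f ∘ suc)
  ∑-allFin-suc {n} f = cong (λ l → f zero + sum l)
    (trans (map-tabulate suc f) (sym (map-tabulate id (f ∘ suc))))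

  ∑-0 : ∀ {A : Set} (l : List A) → ∑ l (λ _ → 0) ≡ 0
  ∑-0 l = trans (∑-const l 0) (*-zeroʳ (length l))

  ∑-δ : ∀ {n} (x : Fin n) (f : Fin n → ℕ) → ∑ (allFin n) (λ y → δ x y * f y) ≡ f x
  ∑-δ {suc n} zero f = begin
      ∑ (allFin (suc n)) (λ y → δ zero y * f y)
    ≡⟨ ∑-allFin-suc (λ y → δ zero y * f y) ⟩
      f zero + 0 + ∑ (allFin n) (λ _ → 0)
    ≡⟨ cong₂ _+_ (+-identityʳ (f zero)) (∑-0 (allFin n)) ⟩
      f zero + 0
    ≡⟨ +-identityʳ (f zero) ⟩
      f zero
    ∎
    where open ≡-Reasoning
  ∑-δ {suc n} (suc x) f = begin
      ∑ (allFin (suc n)) (λ y → δ (suc x) y * f y)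
    ≡⟨ ∑-allFin-suc (λ y → δ (suc x) y * f y) ⟩
      ∑ (allFin n) (λ y → δ (suc x) (suc y) * f (suc y))
    ≡⟨ ∑-cong (allFin n) (λ y → cong (_* f (suc y)) (δ-suc x y)) ⟩
      ∑ (allFin n) (λ y → δ x y * f (suc y))
    ≡⟨ ∑-δ x (f ∘ suc) ⟩
      f (suc x)
    ∎
    where open ≡-Reasoning

  -- Boolean-valued so that adding degrees becomes `_xor_` and the set of wrong-parity vertices can
  -- be filtered out of the vertex list.
  odd : ℕ → Bool
  odd zero    = false
  odd (suc n) = not (odd n)

  odd-+ : ∀ m n → odd (m + n) ≡ odd m xor odd n
  odd-+ zero    n = refl
  odd-+ (suc m) n rewrite odd-+ m n with odd m | odd n
  ... | true  | true  = refl
  ... | true  | false = refl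
  ... | false | _     = refl

  odd-2* : ∀ m → odd (2 * m) ≡ false
  odd-2* m rewrite +-identityʳ m | odd-+ m m with odd m
  ... | true  = refl
  ... | false = refl

  odd-𝟙 : ∀ b → odd (𝟙 b) ≡ b
  odd-𝟙 true  = refl
  odd-𝟙 false = refl

  odd-∑ : ∀ {A : Set} (l : List A) {f g} → (∀ x → odd (f x) ≡ odd (g x)) →
    odd (∑ l f) ≡ odd (∑ l g)
  odd-∑ []      e = refl
  odd-∑ (x ∷ l) {f} {g} e = begin
      odd (f x + ∑ l f)          ≡⟨ odd-+ (f x) _ ⟩
      odd (f x) xor odd (∑ l f)  ≡⟨ cong₂ _xor_ (e x) (odd-∑ l e) ⟩
      odd (g x) xor odd (∑ l g)  ≡⟨ odd-+ (g x) _ ⟨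
      odd (g x + ∑ l g)          ∎
    where open ≡-Reasoning

  even⇒double : ∀ m → odd m ≡ false → ∃[ j ] m ≡ 2 * j
  even⇒double zero          e = 0 , refl
  even⇒double (suc (suc m)) e with even⇒double m (trans (sym (not-involutive (odd m))) e)
  ... | j , refl = suc j , cong suc (sym (+-suc j _))

  odd⇒%2 : ∀ m → odd m ≡ true → m % 2 ≡ 1
  odd⇒%2 (suc zero)    e = refl
  odd⇒%2 (suc (suc m)) e = odd⇒%2 m (trans (sym (not-involutive (odd m))) e)

-- Vertex lists up to permutation, and pairings.

module Combinatorics where

  open import Data.Bool using (Bool; true; false; not; _∧_; _∨_; _xor_)
  import Data.Bool.Properties as Bool
  open import Data.Empty using (⊥-elim)
  open import Data.Fin using (Fin; _≟_)
  open import Data.Fin.Subset using (Subset; ∣_∣; _∈_; _∉_)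
  open import Data.List using (List; []; _∷_; _++_; map; length; allFin; filterᵇ)
  open import Data.List.Properties using (length-++; length-tabulate)
  open import Data.List.Membership.Propositional using (find) renaming (_∈_ to _∈ₗ_)
  open import Data.List.Membership.Propositional.Properties using (∈-allFin; ∈-filter⁻)
  open import Data.List.Relation.Binary.Permutation.Propositional
    using (_↭_; refl; prep; swap; trans; ↭-refl; ↭-prep; ↭-swap; ↭-sym; ↭-trans; ↭-reflexive
          ; ↭⇒↭ₛ)
  open import Data.List.Relation.Binary.Permutation.Propositional.Properties
    using (shift; ↭-length; ++-comm; ++⁺ˡ)
  open import Data.List.Relation.Binary.Permutation.Setoid.Properties using (Unique-resp-↭)
  open import Data.List.Relation.Unary.All as All using (All; []; _∷_)
  open import Data.List.Relation.Unary.All.Properties using (¬Any⇒All¬) renaming (map⁺ to All-map⁺)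
  open import Data.List.Relation.Unary.AllPairs using (AllPairs; []; _∷_)
  open import Data.List.Relation.Unary.Any as Any using (Any; here; there)
  open import Data.List.Relation.Unary.Unique.Propositional using (Unique)
  open import Data.List.Relation.Unary.Unique.Propositional.Properties using (allFin⁺; filter⁺)
  open import Data.Nat hiding (_≟_)
  open import Data.Nat.Properties hiding (_≟_)
  open import Data.Nat.Divisibility using (_∣_; divides)
  open import Data.Nat.Tactic.RingSolver using (solve-∀)
  open import Data.Product using (∃-syntax; Σ-syntax; _×_; _,_; proj₁; proj₂)
  open import Data.Sum using (_⊎_; inj₁; inj₂)
  open import Data.Vec as Vec using (lookup; tabulate)
  open import Data.Vec.Properties using (lookup∘tabulate; []=⇒lookup; lookup⇒[]=)
  open import Function using (_∘_; Equivalence)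
  open import Relation.Binary.PropositionalEquality hiding (trans)
  import Relation.Binary.PropositionalEquality as ≡
  open import Relation.Nullary using (¬_; Dec; yes; no)
  open import Relation.Nullary.Decidable using (⌊_⌋; _×-dec_; _⊎-dec_; ¬?; T?; decidable-stable)
  open Sums

  ∈⇒↭ : ∀ {A : Set} {x : A} {l} → x ∈ₗ l → ∃[ m ] l ↭ x ∷ m
  ∈⇒↭ {l = x ∷ l} (here refl) = l , ↭-refl
  ∈⇒↭ {l = y ∷ l} (there x∈l) with ∈⇒↭ x∈l
  ... | m , π = y ∷ m , ↭-trans (↭-prep y π) (↭-swap y _ ↭-refl)

  extract : ∀ {A : Set} {P : A → Set} {l} → Any P l → ∃[ x ] ∃[ m ] (P x × l ↭ x ∷ m)
  extract any with find any
  ... | x , x∈l , px with ∈⇒↭ x∈l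
  ...   | m , π = x , m , px , π

  ∣X∣≡∑ : ∀ {n} (X : Subset n) → ∣ X ∣ ≡ ∑ (allFin n) (𝟙 ∘ lookup X)
  ∣X∣≡∑ Vec.[] = refl
  ∣X∣≡∑ (true  Vec.∷ X) =
    ≡.trans (cong suc (∣X∣≡∑ X)) (sym (∑-allFin-suc (𝟙 ∘ lookup (true Vec.∷ X))))
  ∣X∣≡∑ (false Vec.∷ X) =
    ≡.trans (∣X∣≡∑ X) (sym (∑-allFin-suc (𝟙 ∘ lookup (false Vec.∷ X))))

  length-allFin : ∀ n → length (allFin n) ≡ n
  length-allFin n = length-tabulate {n = n} (λ i → i)

  -- Serves two purposes: pairings of the same vertices are those with flattenings related by `_↭_`,
  -- and for a set `E` of edges `∑ (flat E) (δ x)` is the degree of `x` in `E`.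
  flat : ∀ {A : Set} → List (A × A) → List A
  flat []            = []
  flat ((a , b) ∷ L) = a ∷ b ∷ flat L

  flat-↭ : ∀ {A : Set} {L M : List (A × A)} → L ↭ M → flat L ↭ flat M
  flat-↭ refl                        = refl
  flat-↭ (prep (a , b) π)            = prep a (prep b (flat-↭ π))
  flat-↭ (swap (a , b) (c , d) π)    =
    trans (prep a (swap b c refl))
      (trans (swap a c (swap b d refl))
        (prep c (trans (swap a d refl) (prep d (prep a (prep b (flat-↭ π)))))))
  flat-↭ (trans π ρ)                 = trans (flat-↭ π) (flat-↭ ρ)

  -- Supplies the arbitrary initial pairing, not yet made of edges, that the exchange argument
  -- improves.
  pairUp : ∀ {A : Set} (l : List A) → odd (length l) ≡ false → ∃[ L ] flat L ≡ l
  pairUp []          e = [] , refl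
  pairUp (a ∷ b ∷ l) e with pairUp l (≡.trans (sym (Bool.not-involutive _)) e)
  ... | L , refl = (a , b) ∷ L , refl

  -- Non-adjacent pairs, the handshake lemma and perfect matchings by exchange.

  module _ {n} (G : Graph n) where

    -- N is 1 on the diagonal, so □ l is |l| plus twice the number of non-adjacent pairs in l,
    -- and 3 |l| ≤ □ l + 2 says that there are at least |l| - 1 such pairs.
    A N : Fin n → Fin n → ℕ
    A x y = 𝟙 (adj G x y)
    N x y = 𝟙 (not (adj G x y))

    A-sym : ∀ x y → A x y ≡ A y x
    A-sym x y = cong 𝟙 (adj-sym G x y)

    N-sym : ∀ x y → N x y ≡ N y x
    N-sym x y = cong (𝟙 ∘ not) (adj-sym G x y)

    N-refl : ∀ x → N x x ≡ 1
    N-refl x = cong (𝟙 ∘ not) (adj-irrefl G x)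

    open Square N N-sym public

    Edge : Fin n × Fin n → Set
    Edge (a , b) = Adjacent G a b

    edge? : ∀ e → Dec (Edge e)
    edge? (a , b) = adj G a b Bool.≟ true

    ¬adj⇒N : ∀ {x y} → ¬ Adjacent G x y → N x y ≡ 1
    ¬adj⇒N {x} {y} ¬a with adj G x y
    ... | true  = ⊥-elim (¬a refl)
    ... | false = refl

    adj⇒N : ∀ {x y} → Adjacent G x y → N x y ≡ 0
    adj⇒N a rewrite a = refl

    N⇒adj : ∀ {x y} → N x y ≡ 0 → Adjacent G x y
    N⇒adj {x} {y} e with adj G x y
    ... | true = refl

    degree≡∑ : ∀ x → degree G x ≡ ∑ (allFin n) (A x)
    degree≡∑ x = ≡.trans (∣X∣≡∑ (tabulate (adj G x)))
      (∑-cong (allFin n) (λ y → cong 𝟙 (lookup∘tabulate (adj G x) y)))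

    degree+∑N : ∀ x → degree G x + ∑ (allFin n) (N x) ≡ n
    degree+∑N x = begin
        degree G x + ∑ (allFin n) (N x)
      ≡⟨ cong (_+ ∑ (allFin n) (N x)) (degree≡∑ x) ⟩
        ∑ (allFin n) (A x) + ∑ (allFin n) (N x)
      ≡⟨ ∑-+ (allFin n) (A x) (N x) ⟨
        ∑ (allFin n) (λ y → A x y + N x y)
      ≡⟨ ∑-cong (allFin n) A+N ⟩
        ∑ (allFin n) (λ _ → 1)
      ≡⟨ ∑-const (allFin n) 1 ⟩
        length (allFin n) * 1
      ≡⟨ *-identityʳ _ ⟩
        length (allFin n)
      ≡⟨ length-allFin n ⟩
        n
      ∎
      where
      open ≡-Reasoning
      A+N : ∀ y → A x y + N x y ≡ 1
      A+N y with adj G x y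
      ... | true  = refl
      ... | false = refl

    -- The degree sum is the square sum of a symmetric matrix with zero diagonal, so splitting off
    -- one vertex at a time removes an even amount.
    handshake : odd (∑ (allFin n) (degree G)) ≡ false
    handshake = ≡.trans (cong odd (∑-cong (allFin n) degree≡∑)) (even-□ (allFin n))
      where
      module □A = Square A A-sym
      even-□ : ∀ l → odd (□A.□ l) ≡ false
      even-□ []      = refl
      even-□ (x ∷ l) rewrite □A.□-∷ x l | adj-irrefl G x
        | odd-+ (2 * ∑ l (A x)) (□A.□ l) | odd-2* (∑ l (A x)) = even-□ l

    Swappable : Fin n → Fin n → Fin n × Fin n → Set
    Swappable u v (a , b) =
      (Adjacent G u a × Adjacent G v b) ⊎ (Adjacent G u b × Adjacent G v a)

    swappable? : ∀ u v e → Dec (Swappable u v e)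
    swappable? u v (a , b) =
      (edge? (u , a) ×-dec edge? (v , b)) ⊎-dec (edge? (u , b) ×-dec edge? (v , a))

    -- Each of the two possible re-pairings lacks an edge, and the two draw on different terms of
    -- the sum.
    ¬swappable⇒2≤ : ∀ {u v a b} → ¬ Swappable u v (a , b) →
      2 ≤ (N u a + N v b) + (N u b + N v a)
    ¬swappable⇒2≤ {u} {v} {a} {b} ¬s = +-mono-≤
      (one (λ p q → ¬s (inj₁ (p , q)))) (one (λ p q → ¬s (inj₂ (p , q))))
      where
      one : ∀ {x y z w} → (Adjacent G x y → Adjacent G z w → _) → 1 ≤ N x y + N z w
      one {x} {y} {z} {w} ¬pq with adj G x y | adj G z w
      ... | true  | true  = ⊥-elim (¬pq refl refl)
      ... | true  | false = s≤s z≤n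
      ... | false | _     = s≤s z≤n

    blocked-∑ : ∀ {u v R} → All (¬_ ∘ Swappable u v) R →
      length (flat R) ≤ ∑ (flat R) (N u) + ∑ (flat R) (N v)
    blocked-∑ [] = z≤n
    blocked-∑ {u} {v} {(a , b) ∷ R} (¬s ∷ ¬ss) = ≤-trans
      (+-mono-≤ (¬swappable⇒2≤ ¬s) (blocked-∑ ¬ss))
      (≤-reflexive (rearrange (N u a) (N v b) (N u b) (N v a) _ _))
      where
      rearrange : ∀ p q r s t w → (p + q) + (r + s) + (t + w) ≡ (p + (r + t)) + (s + (q + w))
      rearrange = solve-∀

    -- The pair uv is missing, and between {u, v} and `flat R` at least two connections are missing
    -- per pair of `R`. With r the length of `flat R` that makes 1 + r missing pairs; each counts
    -- twice in `□`, and the diagonal adds 2 + r.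
    blocked-□ : ∀ {u v R} → ¬ Adjacent G u v → All (¬_ ∘ Swappable u v) R →
      3 * length (u ∷ v ∷ flat R) ≤ □ (u ∷ v ∷ flat R) + 2
    blocked-□ {u} {v} {R} ¬uv ¬ss
      rewrite □-∷ u (v ∷ flat R) | □-∷ v (flat R) | N-refl u | N-refl v | ¬adj⇒N ¬uv = begin
        3 * (2 + length (flat R))
      ≡⟨ left (length (flat R)) ⟩
        6 + 2 * length (flat R) + length (flat R)
      ≤⟨ +-mono-≤ (+-monoʳ-≤ 6 (*-monoʳ-≤ 2 (blocked-∑ ¬ss)))
           (length≤□ (λ x → ≤-reflexive (sym (N-refl x))) (flat R)) ⟩
        6 + 2 * (∑ (flat R) (N u) + ∑ (flat R) (N v)) + □ (flat R)
      ≡⟨ right (∑ (flat R) (N u)) (∑ (flat R) (N v)) (□ (flat R)) ⟩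
        1 + 2 * (1 + ∑ (flat R) (N u)) + (1 + 2 * ∑ (flat R) (N v) + □ (flat R)) + 2
      ∎
      where
      open ≤-Reasoning
      left : ∀ r → 3 * (2 + r) ≡ 6 + 2 * r + r
      left = solve-∀
      right : ∀ p q s → 6 + 2 * (p + q) + s ≡ 1 + 2 * (1 + p) + (1 + 2 * q + s) + 2
      right = solve-∀

    nonEdges : List (Fin n × Fin n) → ℕ
    nonEdges L = ∑ L (λ e → N (proj₁ e) (proj₂ e))

    -- Exchange argument: a non-edge uv of a pairing is resolved against another pair ab
    -- if {ua, vb} or {ub, va} are edges; otherwise at least two of these four are missing.
    exchange : ∀ L → All Edge L ⊎ 3 * length (flat L) ≤ □ (flat L) + 2
      ⊎ (∃[ M ] (flat M ↭ flat L × nonEdges M < nonEdges L))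
    exchange L with Any.any? (λ e → ¬? (edge? e)) L
    ... | no ¬any = inj₁ (All.map (λ {e} → decidable-stable (edge? e)) (¬Any⇒All¬ L ¬any))
    ... | yes any with extract any
    ...   | (u , v) , R , ¬uv , L↭R with Any.any? (swappable? u v) R
    ...     | no ¬sw = inj₂ (inj₁ (subst₂ (λ p q → 3 * p ≤ q + 2)
                (sym (↭-length (flat-↭ L↭R))) (sym (□-↭ (flat-↭ L↭R)))
                (blocked-□ ¬uv (¬Any⇒All¬ R ¬sw))))
    ...     | yes sw with extract sw
    ...       | (a , b) , S , s , R↭S = inj₂ (inj₂ (swapped s))
      where
      L↭S : L ↭ (u , v) ∷ (a , b) ∷ S
      L↭S = ↭-trans L↭R (↭-prep (u , v) R↭S)
      decreases : ∀ {c d} → Adjacent G u c → Adjacent G v d →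
        nonEdges ((u , c) ∷ (v , d) ∷ S) < nonEdges L
      decreases uc vd rewrite ∑-↭ (λ e → N (proj₁ e) (proj₂ e)) L↭S
        | adj⇒N uc | adj⇒N vd | ¬adj⇒N ¬uv = s≤s (m≤n+m _ (N a b))
      swapped : Swappable u v (a , b) → _
      swapped (inj₁ (ua , vb)) = (u , a) ∷ (v , b) ∷ S
        , ↭-sym (↭-trans (flat-↭ L↭S) (↭-prep u (↭-swap v a ↭-refl)))
        , decreases ua vb
      swapped (inj₂ (ub , va)) = (u , b) ∷ (v , a) ∷ S
        , ↭-sym (↭-trans (flat-↭ L↭S) (↭-prep u
            (↭-trans (↭-prep v (↭-swap a b ↭-refl)) (↭-swap v b ↭-refl))))
        , decreases ub va

    -- Repeats the exchange until it stops. `m` is the fuel: it bounds the number of non-edges in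
    -- the pairing, which every successful exchange lowers. Both alternatives survive permuting the
    -- vertices.
    matching⊎sparse : ∀ m L → nonEdges L ≤ m →
      (∃[ M ] (flat M ↭ flat L × All Edge M)) ⊎ 3 * length (flat L) ≤ □ (flat L) + 2
    matching⊎sparse m L L≤m with exchange L
    ... | inj₁ es            = inj₁ (L , ↭-refl , es)
    ... | inj₂ (inj₁ sparse) = inj₂ sparse
    matching⊎sparse zero    L L≤0 | inj₂ (inj₂ (M , π , M<L)) = ⊥-elim (n≮0 (≤-trans M<L L≤0))
    matching⊎sparse (suc m) L L≤m | inj₂ (inj₂ (M , π , M<L))
      with matching⊎sparse m M (s≤s⁻¹ (≤-trans M<L L≤m))
    ... | inj₁ (M′ , ρ , es) = inj₁ (M′ , ↭-trans ρ π , es)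
    ... | inj₂ sparse        = inj₂ (subst₂ (λ p q → 3 * p ≤ q + 2)
                                       (↭-length π) (□-↭ π) sparse)

  -- Deleting edges and the effect on degrees.

  same : ∀ {n} → Fin n → Fin n → Fin n → Fin n → Bool
  same a b x y = (⌊ x ≟ a ⌋ ∧ ⌊ y ≟ b ⌋) ∨ (⌊ x ≟ b ⌋ ∧ ⌊ y ≟ a ⌋)

  same-sym : ∀ {n} (a b x y : Fin n) → same a b x y ≡ same a b y x
  same-sym a b x y = ≡.trans
    (cong₂ _∨_ (Bool.∧-comm ⌊ x ≟ a ⌋ ⌊ y ≟ b ⌋) (Bool.∧-comm ⌊ x ≟ b ⌋ ⌊ y ≟ a ⌋))
    (Bool.∨-comm (⌊ y ≟ b ⌋ ∧ ⌊ x ≟ a ⌋) _)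

  deleteEdge : ∀ {n} → Graph n → Fin n → Fin n → Graph n
  deleteEdge G a b = record
    { adj        = λ x y → adj G x y ∧ not (same a b x y)
    ; adj-sym    = λ x y → cong₂ (λ p q → p ∧ not q) (adj-sym G x y) (same-sym a b x y)
    ; adj-irrefl = λ x → cong (_∧ not (same a b x x)) (adj-irrefl G x)
    }

  module _ {n} (G : Graph n) {a b} (ab : Adjacent G a b) where

    a≢b : a ≢ b
    a≢b refl with ≡.trans (sym ab) (adj-irrefl G a)
    ... | ()

    -- Additive, to avoid truncated subtraction. The two products mark the entries (a, b) and (b,
    -- a), which differ because `a ≢ b`; summing over `y` leaves `δ x a + δ x b`.
    deleteEdge-A : ∀ x y →
      A (deleteEdge G a b) x y + (δ y b * δ x a + δ y a * δ x b) ≡ A G x y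
    deleteEdge-A x y with x ≟ a | y ≟ b | x ≟ b | y ≟ a
    ... | yes p | yes _ | yes r | _     = ⊥-elim (a≢b (≡.trans (sym p) r))
    ... | yes p | no _  | yes r | yes _ = ⊥-elim (a≢b (≡.trans (sym p) r))
    ... | yes p | yes q | no _  | yes _ rewrite ≡.trans (cong₂ (adj G) p q) ab = refl
    ... | yes p | yes q | no _  | no _  rewrite ≡.trans (cong₂ (adj G) p q) ab = refl
    ... | no _  | yes _ | yes r | yes s
      rewrite ≡.trans (cong₂ (adj G) r s) (≡.trans (adj-sym G b a) ab) = refl
    ... | no _  | no _  | yes r | yes s
      rewrite ≡.trans (cong₂ (adj G) r s) (≡.trans (adj-sym G b a) ab) = refl
    ... | yes _ | no _  | yes _ | no _  = ≡.trans (+-identityʳ _) (cong 𝟙 (Bool.∧-identityʳ _))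
    ... | yes _ | no _  | no _  | yes _ = ≡.trans (+-identityʳ _) (cong 𝟙 (Bool.∧-identityʳ _))
    ... | yes _ | no _  | no _  | no _  = ≡.trans (+-identityʳ _) (cong 𝟙 (Bool.∧-identityʳ _))
    ... | no _  | yes _ | yes _ | no _  = ≡.trans (+-identityʳ _) (cong 𝟙 (Bool.∧-identityʳ _))
    ... | no _  | yes _ | no _  | yes _ = ≡.trans (+-identityʳ _) (cong 𝟙 (Bool.∧-identityʳ _))
    ... | no _  | yes _ | no _  | no _  = ≡.trans (+-identityʳ _) (cong 𝟙 (Bool.∧-identityʳ _))
    ... | no _  | no _  | yes _ | no _  = ≡.trans (+-identityʳ _) (cong 𝟙 (Bool.∧-identityʳ _))
    ... | no _  | no _  | no _  | yes _ = ≡.trans (+-identityʳ _) (cong 𝟙 (Bool.∧-identityʳ _))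
    ... | no _  | no _  | no _  | no _  = ≡.trans (+-identityʳ _) (cong 𝟙 (Bool.∧-identityʳ _))

    deleteEdge-degree : ∀ x → degree (deleteEdge G a b) x + (δ x a + δ x b) ≡ degree G x
    deleteEdge-degree x = begin
        degree G′ x + (δ x a + δ x b)
      ≡⟨ cong₂ _+_ (degree≡∑ G′ x) (cong₂ _+_ (sym (∑δ b (δ x a))) (sym (∑δ a (δ x b)))) ⟩
        ∑ V (A G′ x) + (∑ V (λ y → δ y b * δ x a) + ∑ V (λ y → δ y a * δ x b))
      ≡⟨ cong (∑ V (A G′ x) +_) (∑-+ V (λ y → δ y b * δ x a) _) ⟨
        ∑ V (A G′ x) + ∑ V (λ y → δ y b * δ x a + δ y a * δ x b)
      ≡⟨ ∑-+ V (A G′ x) _ ⟨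
        ∑ V (λ y → A G′ x y + (δ y b * δ x a + δ y a * δ x b))
      ≡⟨ ∑-cong V (deleteEdge-A x) ⟩
        ∑ V (A G x)
      ≡⟨ degree≡∑ G x ⟨
        degree G x
      ∎
      where
      open ≡-Reasoning
      G′ = deleteEdge G a b
      V  = allFin n
      ∑δ : ∀ b c → ∑ V (λ y → δ y b * c) ≡ c
      ∑δ b c = ≡.trans (∑-cong V (λ y → cong (_* c) (δ-sym y b))) (∑-δ b (λ _ → c))

  -- Inequality of unordered pairs. Disjointness would be too strong, since the edges of a star
  -- share the hub.
  Distinct : ∀ {n} → Fin n × Fin n → Fin n × Fin n → Set
  Distinct (a , b) (c , d) = ¬ (c ≡ a × d ≡ b) × ¬ (c ≡ b × d ≡ a)

  deleteEdge-keeps : ∀ {n} (G : Graph n) {a b c d} → Distinct (a , b) (c , d) →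
    Adjacent G c d → Adjacent (deleteEdge G a b) c d
  deleteEdge-keeps G {a} {b} {c} {d} (¬p , ¬q) cd rewrite cd
    with c ≟ a | d ≟ b | c ≟ b | d ≟ a
  ... | yes p | yes q | _     | _     = ⊥-elim (¬p (p , q))
  ... | _     | _     | yes p | yes q = ⊥-elim (¬q (p , q))
  ... | yes _ | no _  | yes _ | no _  = refl
  ... | yes _ | no _  | no _  | _     = refl
  ... | no _  | _     | yes _ | no _  = refl
  ... | no _  | _     | no _  | _     = refl

  -- Distinctness ensures that the edges still to be deleted are present after each deletion, so
  -- every step really lowers the two degrees.
  deleteEdges : ∀ {n} (G : Graph n) E → All (Edge G) E → AllPairs Distinct E →
    Σ[ F ∈ Graph n ] (IsSpanningSubgraph F G ×
      (∀ x → degree F x + ∑ (flat E) (δ x) ≡ degree G x))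
  deleteEdges G [] [] [] = G , (λ _ _ e → e) , λ x → +-identityʳ _
  deleteEdges G ((a , b) ∷ E) (ab ∷ es) (ds ∷ dss)
    with deleteEdges (deleteEdge G a b) E
           (All.zipWith (λ (d , e) → deleteEdge-keeps G d e) (ds , es)) dss
  ... | F , F⊆ , deg = F , (λ u v e → ∧-true (F⊆ u v e)) , λ x → begin
        degree F x + (δ x a + (δ x b + ∑ (flat E) (δ x)))
      ≡⟨ rearrange (degree F x) (δ x a) (δ x b) _ ⟩
        degree F x + ∑ (flat E) (δ x) + (δ x a + δ x b)
      ≡⟨ cong (_+ (δ x a + δ x b)) (deg x) ⟩
        degree (deleteEdge G a b) x + (δ x a + δ x b)
      ≡⟨ deleteEdge-degree G ab x ⟩
        degree G x
      ∎
    where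
    open ≡-Reasoning
    ∧-true : ∀ {p q} → p ∧ q ≡ true → p ≡ true
    ∧-true {true} _ = refl
    rearrange : ∀ p q r s → p + (q + (r + s)) ≡ p + s + (q + r)
    rearrange = solve-∀

  -- Integrality recovers the one unit left over in the counting estimates below.
  half≤ : ∀ a b → 2 * a ≤ suc (2 * b) → a ≤ b
  half≤ a b p = s≤s⁻¹ (*-cancelˡ-< 2 a (suc b) (≤-trans (s≤s p) (≤-reflexive (sym (*-suc 2 b)))))

  -- Fewer than n - k missing pairs: minimum degree and the hub of a star.

  module _ {n} (k : ℕ) (G : Graph n) (dense : □ G (allFin n) + 2 * k < 3 * n) where

    private V = allFin n

    -- Each non-neighbour of `x` costs two in `□ G V` and one in the degree, so the non-neighbours
    -- cancel and only the missing pairs away from `x` remain.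
    degree-bound : ∀ {x l} → V ↭ x ∷ l → □ G l + 2 * k ≤ n + 2 * degree G x
    degree-bound {x} {l} π = +-cancelˡ-≤ (suc (2 * r)) _ _ (s≤s⁻¹ (begin
        suc (suc (2 * r) + (□ G l + 2 * k))
      ≡⟨ cong suc (+-assoc (suc (2 * r)) _ _) ⟨
        suc (suc (2 * r) + □ G l + 2 * k)
      ≡⟨ cong (λ s → suc (s + 2 * k)) □≡ ⟨
        suc (□ G V + 2 * k)
      ≤⟨ dense ⟩
        3 * n
      ≡⟨ cong (λ s → n + 2 * s) n≡ ⟨
        n + 2 * (degree G x + suc r)
      ≡⟨ rearrange n (degree G x) r ⟩
        suc (suc (2 * r) + (n + 2 * degree G x))
      ∎))
      where
      open ≤-Reasoning
      r = ∑ l (N G x)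
      □≡ : □ G V ≡ suc (2 * r) + □ G l
      □≡ = ≡.trans (□-↭ G π)
        (≡.trans (□-∷ G x l) (cong (λ s → s + 2 * r + □ G l) (N-refl G x)))
      n≡ : degree G x + suc r ≡ n
      n≡ = ≡.trans (cong (degree G x +_) (sym (≡.trans (∑-↭ (N G x) π)
        (cong (_+ r) (N-refl G x))))) (degree+∑N G x)
      rearrange : ∀ a b c → a + 2 * (b + suc c) ≡ suc (suc (2 * c) + (a + 2 * b))
      rearrange = solve-∀

    length≤□V : ∀ l → length l ≤ □ G l
    length≤□V = length≤□ G (λ x → ≤-reflexive (sym (N-refl G x)))

    k≤degree : ∀ x → k ≤ degree G x
    k≤degree x with ∈⇒↭ (∈-allFin x)
    ... | l , π = half≤ k (degree G x) (+-cancelˡ-≤ (length l) _ _ (begin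
        length l + 2 * k           ≤⟨ +-monoˡ-≤ (2 * k) (length≤□V l) ⟩
        □ G l + 2 * k              ≤⟨ degree-bound π ⟩
        n + 2 * degree G x         ≡⟨ cong (_+ 2 * degree G x) (length-allFin n) ⟨
        length V + 2 * degree G x  ≡⟨ cong (_+ 2 * degree G x) (↭-length π) ⟩
        suc (length l + 2 * degree G x) ≡⟨ +-suc (length l) _ ⟨
        length l + suc (2 * degree G x) ∎))
      where open ≤-Reasoning

    -- The missing pairs inside `t` all avoid `w`, so `degree-bound` turns them into extra degree at
    -- `w`. The `suc` means that deleting a star with `length t` edges may leave degree k - 1 at the
    -- hub.
    hub-degree : ∀ {w t l} → V ↭ t ++ w ∷ l → 3 * length t ≤ □ G t + 2 →
      k + length t ≤ suc (degree G w)
    hub-degree {w} {t} {l} π sparse = half≤ _ _ (+-cancelˡ-≤ (length t + length l) _ _ (begin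
        length t + length l + 2 * (k + length t)
      ≡⟨ left (length t) (length l) k ⟩
        3 * length t + length l + 2 * k
      ≤⟨ +-monoˡ-≤ (2 * k) (+-mono-≤ sparse (length≤□V l)) ⟩
        □ G t + 2 + □ G l + 2 * k
      ≡⟨ mid (□ G t) (□ G l) (2 * k) ⟩
        □ G t + □ G l + 2 * k + 2
      ≤⟨ +-monoˡ-≤ 2 (+-monoˡ-≤ (2 * k)
           (≤-trans (m≤m+n (□ G t + □ G l) _) (≤-reflexive (sym (□-++ G t l))))) ⟩
        □ G (t ++ l) + 2 * k + 2
      ≤⟨ +-monoˡ-≤ 2 (degree-bound (↭-trans π (shift w t l))) ⟩
        n + 2 * degree G w + 2
      ≡⟨ cong (λ m → m + 2 * degree G w + 2) n≡ ⟩
        suc (length t + length l) + 2 * degree G w + 2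
      ≡⟨ right (length t) (length l) (degree G w) ⟩
        length t + length l + suc (2 * suc (degree G w))
      ∎))
      where
      open ≤-Reasoning
      n≡ : n ≡ suc (length t + length l)
      n≡ = ≡.trans (sym (length-allFin n)) (≡.trans (↭-length (↭-trans π (shift w t l)))
        (cong suc (length-++ t)))
      left : ∀ a b c → a + b + 2 * (c + a) ≡ 3 * a + b + 2 * c
      left = solve-∀
      mid : ∀ a b c → a + 2 + b + c ≡ a + b + c + 2
      mid = solve-∀
      right : ∀ a b c → suc (a + b) + 2 * c + 2 ≡ a + b + suc (2 * suc c)
      right = solve-∀

    -- Otherwise every vertex of `w` misses some vertex of `t`. Together with the |t| - 1 missing
    -- pairs inside `t` that gives at least n - 1 of them, whereas fewer than n - k exist.
    hub-exists : 1 ≤ k → ∀ {t w} → V ↭ t ++ w → 3 * length t ≤ □ G t + 2 →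
      Any (λ x → ∑ t (N G x) ≡ 0) w
    hub-exists 1≤k {t} {w} π sparse with Any.any? (λ x → ∑ t (N G x) ℕ≟ 0) w
      where open import Data.Nat renaming (_≟_ to _ℕ≟_)
    ... | yes any = any
    ... | no ¬any = ⊥-elim (<-irrefl refl (begin-strict
        3 * n
      ≡⟨ cong (3 *_) n≡ ⟩
        3 * (length t + length w)
      ≡⟨ left (length t) (length w) ⟩
        3 * length t + (length w + 2 * length w)
      ≤⟨ +-mono-≤ sparse (+-mono-≤ (length≤□V w) (*-monoʳ-≤ 2 rows)) ⟩
        □ G t + 2 + (□ G w + 2 * ∑∑ w t (N G))
      ≡⟨ right (□ G t) (□ G w) (∑∑ w t (N G)) ⟩
        □ G w + □ G t + 2 * ∑∑ w t (N G) + 2 * 1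
      ≡⟨ cong (_+ 2 * 1) (≡.trans (□-↭ G (↭-trans π (++-comm t w))) (□-++ G w t)) ⟨
        □ G V + 2 * 1
      ≤⟨ +-monoʳ-≤ (□ G V) (*-monoʳ-≤ 2 1≤k) ⟩
        □ G V + 2 * k
      <⟨ dense ⟩
        3 * n
      ∎))
      where
      open ≤-Reasoning
      n≡ : n ≡ length t + length w
      n≡ = ≡.trans (sym (length-allFin n)) (≡.trans (↭-length π) (length-++ t))
      rows : length w ≤ ∑∑ w t (N G)
      rows = length≤∑ w (λ x∈w → n≢0⇒n>0 (All.lookup (¬Any⇒All¬ w ¬any) x∈w))
      left : ∀ a b → 3 * (a + b) ≡ 3 * a + (b + 2 * b)
      left = solve-∀
      right : ∀ a b c → a + 2 + (b + 2 * c) ≡ b + a + 2 * c + 2 * 1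
      right = solve-∀

  -- From a matching or a star to the spanning subgraph.

  matching-distinct : ∀ {n} (E : List (Fin n × Fin n)) → Unique (flat E) → AllPairs Distinct E
  matching-distinct []            _                        = []
  matching-distinct ((a , b) ∷ E) ((_ ∷ a∉) ∷ _ ∷ unique) =
    distinct E a∉ ∷ matching-distinct E unique
    where
    distinct : ∀ {a b} E → All (a ≢_) (flat E) → All (Distinct (a , b)) E
    distinct []            []               = []
    distinct ((c , d) ∷ E) (a≢c ∷ a≢d ∷ a∉) =
      ((λ p → a≢c (sym (proj₁ p))) , (λ p → a≢d (sym (proj₂ p)))) ∷ distinct E a∉

  star-distinct : ∀ {n} (w : Fin n) {t} → Unique t → AllPairs Distinct (map (w ,_) t)
  star-distinct w []                 = []
  star-distinct w (_∷_ {x} x∉ unique) =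
    All-map⁺ (All.map (λ x≢y → (λ p → x≢y (sym (proj₂ p)))
                             , (λ p → x≢y (≡.trans (sym (proj₁ p)) (sym (proj₂ p))))) x∉)
    ∷ star-distinct w unique

  ∑-flat-star : ∀ {A : Set} (w : A) t f → ∑ (flat (map (w ,_) t)) f ≡ length t * f w + ∑ t f
  ∑-flat-star w []      f = refl
  ∑-flat-star w (x ∷ t) f rewrite ∑-flat-star w t f = rearrange (f w) (f x) _ _
    where
    rearrange : ∀ a b c d → a + (b + (c + d)) ≡ a + c + (b + d)
    rearrange = solve-∀

  odd-∣ : ∀ {m} → 2 ∣ m → odd m ≡ false
  odd-∣ (divides q refl) = ≡.trans (cong odd (*-comm q 2)) (odd-2* q)

  -- The value m = k - 1 allowed by the inequality is excluded by parity.
  even-excess : ∀ {k m} → odd k ≡ false → odd m ≡ false → k ≤ suc m → ∃[ j ] m ≡ k + 2 * j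
  even-excess {k} {m} ek em k≤1+m with even⇒double k ek | even⇒double m em
  ... | i , refl | j , refl = j ∸ i , (begin
      2 * j                 ≡⟨ cong (2 *_) (m+[n∸m]≡n (half≤ i j k≤1+m)) ⟨
      2 * (i + (j ∸ i))     ≡⟨ *-distribˡ-+ 2 i (j ∸ i) ⟩
      2 * i + 2 * (j ∸ i)   ∎)
    where open ≡-Reasoning

  strongParity : ∀ {n} k (G : Graph n) → 1 ≤ k → 2 ∣ k →
    □ G (allFin n) + 2 * k < 3 * n → StrongParityProperty k G
  strongParity {n} k G 1≤k 2∣k dense X 2∣X = choose
    (matching⊎sparse G (nonEdges G L) L ≤-refl)
    where
    V = allFin n

    T : Fin n → Bool
    T x = odd (degree G x) xor lookup X x

    t w : List (Fin n)
    t = filterᵇ T V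
    w = filterᵇ (not ∘ T) V

    Goal = Σ[ F ∈ Graph n ] (IsSpanningSubgraph F G
      × (∀ u → u ∈ X → degree F u % 2 ≡ 1)
      × (∀ v → v ∉ X → ∃[ j ] degree F v ≡ k + 2 * j))

    -- Common end of both cases: it is enough that `E` has odd degree exactly on `T` and leaves
    -- degree at least k - 1 everywhere.
    delete : ∀ E → All (Edge G) E → AllPairs Distinct E →
      (∀ x → odd (∑ (flat E) (δ x)) ≡ T x) →
      (∀ x → k + ∑ (flat E) (δ x) ≤ suc (degree G x)) → Goal
    delete E es ds parity room with deleteEdges G E es ds
    ... | F , F⊆G , deg = F , F⊆G
      , (λ u u∈X → odd⇒%2 (degree F u) (≡.trans (odd-F u) ([]=⇒lookup u∈X)))
      , (λ v v∉X → even-excess (odd-∣ 2∣k) (≡.trans (odd-F v) (lookup-∉ v v∉X)) (k≤F v))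
      where
      lookup-∉ : ∀ v → v ∉ X → lookup X v ≡ false
      lookup-∉ v v∉X = Bool.¬-not (λ e → v∉X (lookup⇒[]= v X e))
      xor-cancel : ∀ p q r → p xor (q xor r) ≡ q → p ≡ r
      xor-cancel true  true  true  _ = refl
      xor-cancel true  false true  _ = refl
      xor-cancel false true  false _ = refl
      xor-cancel false false false _ = refl
      odd-F : ∀ v → odd (degree F v) ≡ lookup X v
      odd-F v = xor-cancel (odd (degree F v)) (odd (degree G v)) (lookup X v) (begin
          odd (degree F v) xor T v
        ≡⟨ cong (odd (degree F v) xor_) (parity v) ⟨
          odd (degree F v) xor odd (∑ (flat E) (δ v))
        ≡⟨ odd-+ (degree F v) _ ⟨
          odd (degree F v + ∑ (flat E) (δ v))
        ≡⟨ cong odd (deg v) ⟩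
          odd (degree G v)
        ∎)
        where open ≡-Reasoning
      k≤F : ∀ v → k ≤ suc (degree F v)
      k≤F v = +-cancelʳ-≤ (∑ (flat E) (δ v)) k _
        (≤-trans (room v) (≤-reflexive (cong suc (sym (deg v)))))

    length-t : length t ≡ ∑ V (𝟙 ∘ T)
    length-t = begin
        length t                   ≡⟨ *-identityʳ _ ⟨
        length t * 1               ≡⟨ ∑-const t 1 ⟨
        ∑ t (λ _ → 1)              ≡⟨ ∑-filter T V (λ _ → 1) ⟩
        ∑ V (λ x → 𝟙 (T x) * 1)    ≡⟨ ∑-cong V (λ x → *-identityʳ _) ⟩
        ∑ V (𝟙 ∘ T)                ∎
      where open ≡-Reasoning

    -- Modulo 2, |T| is the degree sum plus |X|; the first is even by the handshake lemma, the
    -- second by assumption.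
    even-t : odd (length t) ≡ false
    even-t = begin
        odd (length t)
      ≡⟨ cong odd length-t ⟩
        odd (∑ V (𝟙 ∘ T))
      ≡⟨ odd-∑ V (λ x → ≡.trans (odd-𝟙 (T x)) (sym (≡.trans (odd-+ (degree G x) _)
           (cong (odd (degree G x) xor_) (odd-𝟙 (lookup X x)))))) ⟩
        odd (∑ V (λ x → degree G x + 𝟙 (lookup X x)))
      ≡⟨ cong odd (∑-+ V (degree G) _) ⟩
        odd (∑ V (degree G) + ∑ V (𝟙 ∘ lookup X))
      ≡⟨ odd-+ (∑ V (degree G)) _ ⟩
        odd (∑ V (degree G)) xor odd (∑ V (𝟙 ∘ lookup X))
      ≡⟨ cong₂ _xor_ (handshake G) (≡.trans (cong odd (sym (∣X∣≡∑ X))) (odd-∣ 2∣X)) ⟩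
        false
      ∎
      where open ≡-Reasoning

    L = proj₁ (pairUp t even-t)
    flat-L : flat L ≡ t
    flat-L = proj₂ (pairUp t even-t)

    unique-t : Unique t
    unique-t = filter⁺ (λ x → T? (T x)) (allFin⁺ n)

    ∑δ-t : ∀ x → ∑ t (δ x) ≡ 𝟙 (T x)
    ∑δ-t x = begin
        ∑ t (δ x)                    ≡⟨ ∑-filter T V (δ x) ⟩
        ∑ V (λ y → 𝟙 (T y) * δ x y)  ≡⟨ ∑-cong V (λ y → *-comm (𝟙 (T y)) _) ⟩
        ∑ V (λ y → δ x y * 𝟙 (T y))  ≡⟨ ∑-δ x (𝟙 ∘ T) ⟩
        𝟙 (T x)                      ∎
      where open ≡-Reasoning

    𝟙≤1 : ∀ b → 𝟙 b ≤ 1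
    𝟙≤1 true  = s≤s z≤n
    𝟙≤1 false = z≤n

    room-T : ∀ x → k + 𝟙 (T x) ≤ suc (degree G x)
    room-T x = ≤-trans (+-mono-≤ (k≤degree k G dense x) (𝟙≤1 (T x))) (≤-reflexive (+-comm _ 1))

    -- The hub loses |T| edges, an even number, which is right because it lies outside `T`; every
    -- vertex of `T` loses exactly one.
    star : 3 * length t ≤ □ G t + 2 → Goal
    star sparse with find (hub-exists k G dense 1≤k (↭-filter T V) sparse)
    ... | h , h∈w , ∑≡0 with ∈⇒↭ h∈w
    ...   | l , w↭ = delete (map (h ,_) t)
      (All-map⁺ (All.tabulate λ x∈t → N⇒adj G (n≤0⇒n≡0
        (≤-trans (term≤∑ (N G h) x∈t) (≤-reflexive ∑≡0)))))
      (star-distinct h unique-t)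
      odd-count room
      where
      T-h : T h ≡ false
      T-h = Equivalence.to Bool.T-not-≡ (proj₂ (∈-filter⁻ (λ x → T? (not (T x))) {xs = V} h∈w))
      count : ∀ x → ∑ (flat (map (h ,_) t)) (δ x) ≡ length t * δ x h + 𝟙 (T x)
      count x = ≡.trans (∑-flat-star h t (δ x)) (cong (length t * δ x h +_) (∑δ-t x))
      odd-count : ∀ x → odd (∑ (flat (map (h ,_) t)) (δ x)) ≡ T x
      odd-count x rewrite count x | odd-+ (length t * δ x h) (𝟙 (T x)) | odd-𝟙 (T x) with x ≟ h
      ... | yes _ rewrite *-identityʳ (length t) | even-t = refl
      ... | no _  rewrite *-zeroʳ (length t) = refl
      at-hub : length t * 1 + 𝟙 (T h) ≡ length t
      at-hub = ≡.trans (cong₂ _+_ (*-identityʳ (length t)) (cong 𝟙 T-h)) (+-identityʳ (length t))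
      room′ : ∀ x → k + (length t * δ x h + 𝟙 (T x)) ≤ suc (degree G x)
      room′ x with x ≟ h
      ... | yes refl = subst (λ c → k + c ≤ suc (degree G h)) (sym at-hub)
        (hub-degree k G dense (↭-trans (↭-filter T V) (++⁺ˡ t w↭)) sparse)
      ... | no _     = subst (λ c → k + (c + 𝟙 (T x)) ≤ suc (degree G x))
        (sym (*-zeroʳ (length t))) (room-T x)
      room : ∀ x → k + ∑ (flat (map (h ,_) t)) (δ x) ≤ suc (degree G x)
      room x = subst (λ c → k + c ≤ suc (degree G x)) (sym (count x)) (room′ x)

    choose : _ → Goal
    choose (inj₁ (M , π , es)) = delete M es
      (matching-distinct M (Unique-resp-↭ (setoid _) (↭⇒↭ₛ (↭-sym M↭t)) unique-t))
      (λ x → ≡.trans (cong odd (count x)) (odd-𝟙 (T x)))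
      (λ x → subst (λ c → k + c ≤ suc (degree G x)) (sym (count x)) (room-T x))
      where
      M↭t : flat M ↭ t
      M↭t = ↭-trans π (↭-reflexive flat-L)
      count : ∀ x → ∑ (flat M) (δ x) ≡ 𝟙 (T x)
      count x = ≡.trans (∑-↭ (δ x) M↭t) (∑δ-t x)
    choose (inj₂ sparse) = star (subst (λ l → 3 * length l ≤ □ G l + 2) flat-L sparse)

-- Degree-weighted row sums of Q, and from many edges to few missing pairs.

module DegreeSums where

  open import Data.Bool using (true; false)
  open import Data.Empty using (⊥-elim)
  open import Data.Fin using (Fin; zero; suc; _≟_)
  open import Data.List using (allFin)
  open import Data.List.Membership.Propositional.Properties using (∈-allFin)
  open import Data.Nat hiding (_≟_)
  open import Data.Nat.Properties hiding (_≟_)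
  open import Data.Nat.Tactic.RingSolver using (solve-∀)
  open import Relation.Binary.Construct.Closure.ReflexiveTransitive using (Star; ε; _◅_)
  open import Relation.Binary.PropositionalEquality
  open import Relation.Nullary using (yes; no)
  open Sums
  open Combinatorics

  module _ {p} (G : Graph (suc (suc p))) (1≤degree : ∀ v → 1 ≤ degree G v) where

    private
      V = allFin (suc (suc p))
      d = degree G
      D = ∑ V d
      m = suc p

    degree≤ : ∀ v → d v ≤ m
    degree≤ v = s≤s⁻¹ (begin
        suc (d v)             ≡⟨ +-comm 1 (d v) ⟩
        d v + 1               ≡⟨ cong (d v +_) (N-refl G v) ⟨
        d v + N G v v         ≤⟨ +-monoʳ-≤ (d v) (term≤∑ (N G v) (∈-allFin v)) ⟩
        d v + ∑ V (N G v)     ≡⟨ degree+∑N G v ⟩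
        suc (suc p)           ∎)
      where open ≤-Reasoning

    neighbour-degrees≤ : ∀ v → ∑ V (λ u → A G v u * d u) ≤ d v * m
    neighbour-degrees≤ v = begin
        ∑ V (λ u → A G v u * d u)   ≤⟨ ∑-mono V (λ u → *-monoʳ-≤ (A G v u) (degree≤ u)) ⟩
        ∑ V (λ u → A G v u * m)     ≡⟨ ∑-*ʳ V (A G v) m ⟩
        ∑ V (A G v) * m             ≡⟨ cong (_* m) (degree≡∑ G v) ⟨
        d v * m                     ∎
      where open ≤-Reasoning

    -- Besides the neighbours of v, the sum `D` contains d_v itself and the degrees of the m - d_v
    -- non-neighbours, each at least 1; together these give at least m.
    neighbour-degrees+m≤ : ∀ v → ∑ V (λ u → A G v u * d u) + m ≤ D
    neighbour-degrees+m≤ v = s≤s⁻¹ (begin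
        suc (s + m)
      ≡⟨ +-suc s m ⟨
        s + suc m
      ≡⟨ cong (s +_) (trans (sym (degree+∑N G v))
           (cong (_+ ∑ V (N G v)) (sym (∑-δ v d)))) ⟩
        s + (∑ V (λ u → δ v u * d u) + ∑ V (N G v))
      ≡⟨ cong (s +_) (∑-+ V (λ u → δ v u * d u) (N G v)) ⟨
        s + ∑ V (λ u → δ v u * d u + N G v u)
      ≡⟨ ∑-+ V (λ u → A G v u * d u) _ ⟨
        ∑ V (λ u → A G v u * d u + (δ v u * d u + N G v u))
      ≤⟨ ∑-mono V pointwise ⟩
        ∑ V (λ u → δ v u * 1 + d u)
      ≡⟨ ∑-+ V (λ u → δ v u * 1) d ⟩
        ∑ V (λ u → δ v u * 1) + D
      ≡⟨ cong (_+ D) (∑-δ v (λ _ → 1)) ⟩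
        suc D
      ∎)
      where
      open ≤-Reasoning
      s = ∑ V (λ u → A G v u * d u)
      -- `N` is 1 at v itself as well, which the term `δ v u * 1` on the right pays for.
      pointwise : ∀ u → A G v u * d u + (δ v u * d u + N G v u) ≤ δ v u * 1 + d u
      pointwise u with v ≟ u
      ... | yes refl rewrite adj-irrefl G v | +-identityʳ (d v) = ≤-reflexive (+-comm (d v) 1)
      ... | no _ with adj G v u
      ...   | true  = ≤-reflexive (trans (+-identityʳ _) (+-identityʳ (d u)))
      ...   | false = 1≤degree u

    -- The row sums of Q weighted by the degrees satisfy (Q d)_v ≤ (n - 2 + 2e / (n - 1)) d_v,
    -- cleared of denominators; with h = m - d_v it reduces to h s ≤ h d_v m.
    weighted-row-bound : ∀ v →
      m * (d v * d v + ∑ V (λ u → A G v u * d u)) ≤ (m * p + D) * d v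
    weighted-row-bound v = begin
        m * (a * a + s)
      ≡⟨ cong (_* (a * a + s)) m≡ ⟩
        (a + h) * (a * a + s)
      ≡⟨ left a h s ⟩
        (a + h) * (a * a) + a * s + h * s
      ≤⟨ +-monoʳ-≤ ((a + h) * (a * a) + a * s) (*-monoʳ-≤ h s≤) ⟩
        (a + h) * (a * a) + a * s + h * (a * (a + h))
      ≡⟨ right a h s ⟩
        ((a + h) * (a + h) + s) * a
      ≡⟨ cong (λ c → (c * c + s) * a) m≡ ⟨
        (m * m + s) * a
      ≡⟨ cong (_* a) (split p s) ⟩
        (m * p + (s + m)) * a
      ≤⟨ *-monoˡ-≤ a (+-monoʳ-≤ (m * p) (neighbour-degrees+m≤ v)) ⟩
        (m * p + D) * a
      ∎
      where
      open ≤-Reasoning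
      a = d v
      h = m ∸ a
      s = ∑ V (λ u → A G v u * d u)
      m≡ : m ≡ a + h
      m≡ = sym (m+[n∸m]≡n (degree≤ v))
      s≤ : s ≤ a * (a + h)
      s≤ = subst (λ c → s ≤ a * c) m≡ (neighbour-degrees≤ v)
      left : ∀ a h s → (a + h) * (a * a + s) ≡ (a + h) * (a * a) + a * s + h * s
      left = solve-∀
      right : ∀ a h s →
        (a + h) * (a * a) + a * s + h * (a * (a + h)) ≡ ((a + h) * (a + h) + s) * a
      right = solve-∀
      split : ∀ p s → suc p * suc p + s ≡ suc p * p + (s + suc p)
      split = solve-∀

    Q-row : ∀ v → ∑ V (λ u → signlessLaplacian G v u * d u) ≡
      d v * d v + ∑ V (λ u → A G v u * d u)
    Q-row v = begin
        ∑ V (λ u → (degreeMatrix G v u + A G v u) * d u)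
      ≡⟨ ∑-cong V (λ u → *-distribʳ-+ (d u) (degreeMatrix G v u) (A G v u)) ⟩
        ∑ V (λ u → degreeMatrix G v u * d u + A G v u * d u)
      ≡⟨ ∑-+ V (λ u → degreeMatrix G v u * d u) _ ⟩
        ∑ V (λ u → degreeMatrix G v u * d u) + ∑ V (λ u → A G v u * d u)
      ≡⟨ cong (_+ ∑ V (λ u → A G v u * d u)) (∑-cong V diagonal) ⟩
        ∑ V (λ u → δ v u * (d v * d u)) + ∑ V (λ u → A G v u * d u)
      ≡⟨ cong (_+ ∑ V (λ u → A G v u * d u)) (∑-δ v (λ u → d v * d u)) ⟩
        d v * d v + ∑ V (λ u → A G v u * d u)
      ∎
      where
      open ≡-Reasoning
      diagonal : ∀ u → degreeMatrix G v u * d u ≡ δ v u * (d v * d u)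
      diagonal u with v ≟ u
      ... | yes _ = sym (+-identityʳ _)
      ... | no _  = refl

  connected⇒1≤degree : ∀ {p} (G : Graph (suc (suc p))) → Connected G → ∀ v → 1 ≤ degree G v
  connected⇒1≤degree G connected v = first-edge v (other v) (connected v (other v)) (v≢other v)
    where
    other : ∀ {p} → Fin (suc (suc p)) → Fin (suc (suc p))
    other zero    = suc zero
    other (suc _) = zero
    v≢other : ∀ {p} (v : Fin (suc (suc p))) → v ≢ other v
    v≢other zero    ()
    v≢other (suc _) ()
    first-edge : ∀ v u → Star (Adjacent G) v u → v ≢ u → 1 ≤ degree G v
    first-edge v .v ε                v≢v = ⊥-elim (v≢v refl)
    first-edge v u  (_◅_ {j = w} vw _) _ = begin
        1                      ≡⟨ cong 𝟙 vw ⟨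
        A G v w                ≤⟨ term≤∑ (A G v) (∈-allFin w) ⟩
        ∑ (allFin _) (A G v)   ≡⟨ degree≡∑ G v ⟨
        degree G v             ∎
      where open ≤-Reasoning

  -- Every ordered pair of vertices, the diagonal included, is counted once by the degrees or by
  -- `□`, so the two add up to n². Here n = p + 2 and k = j + 1.
  dense : ∀ {p j} (G : Graph (suc (suc p))) →
    suc p * p + 2 * j < ∑ (allFin (suc (suc p))) (degree G) →
    □ G (allFin (suc (suc p))) + 2 * suc j < 3 * suc (suc p)
  dense {p} {j} G D> = +-cancelˡ-< (suc (suc p * p + 2 * j)) _ _ (begin-strict
      suc (suc p * p + 2 * j) + (□ G V + 2 * suc j)
    ≤⟨ +-monoˡ-≤ (□ G V + 2 * suc j) D> ⟩
      ∑ V (degree G) + (□ G V + 2 * suc j)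
    ≡⟨ +-assoc (∑ V (degree G)) (□ G V) _ ⟨
      ∑ V (degree G) + □ G V + 2 * suc j
    ≡⟨ cong (_+ 2 * suc j) total ⟩
      suc (suc p) * suc (suc p) + 2 * suc j
    <⟨ n<1+n _ ⟩
      suc (suc (suc p) * suc (suc p) + 2 * suc j)
    ≡⟨ rearrange p j ⟩
      suc (suc p * p + 2 * j) + 3 * suc (suc p)
    ∎)
    where
    open ≤-Reasoning
    V = allFin (suc (suc p))
    total : ∑ V (degree G) + □ G V ≡ suc (suc p) * suc (suc p)
    total = trans (sym (∑-+ V (degree G) _)) (trans (∑-cong V (degree+∑N G))
      (trans (∑-const V (suc (suc p))) (cong (_* (suc (suc p))) (length-allFin (suc (suc p))))))
    rearrange : ∀ p j → suc (suc (suc p) * suc (suc p) + 2 * suc j) ≡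
      suc (suc p * p + 2 * j) + 3 * suc (suc p)
    rearrange = solve-∀

-- Rational arithmetic and the estimate for approximate eigenvectors.

module Rationals where

  open import Data.Fin using (Fin; zero; suc)
  open import Data.Integer as ℤ using (+_)
  import Data.Integer.Properties as ℤ
  open import Data.List using (allFin)
  open import Data.List.Membership.Propositional.Properties using (∈-allFin)
  import Data.List.Extrema
  import Data.List.Relation.Unary.All as All
  open import Data.Nat as ℕ using (ℕ; zero; suc)
  import Data.Nat.Properties as ℕ
  open import Data.Product using (∃-syntax; _,_)
  open import Data.Rational
  open import Data.Rational.Properties
  open import Data.Rational.Solver using (module +-*-Solver)
  open import Data.Rational.Unnormalised as ℚᵘ using (mkℚᵘ; *≡*; *≤*)
  import Data.Rational.Unnormalised.Properties as ℚᵘ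
  open import Data.Sum using (inj₁; inj₂)
  open import Data.Vec.Functional using (foldr)
  open import Function using (_∘_)
  open import Relation.Binary.Bundles using (DecTotalOrder)
  open import Relation.Binary.PropositionalEquality
  open Sums using (∑; ∑-allFin-suc)

  -- Opaque, since otherwise unification unfolds the gcd computation in _/_ on open terms.
  opaque

    ι : ℕ → ℚ
    ι n = + n / 1

    1/suc : ℕ → ℚ
    1/suc n = + 1 / suc n

  -- With its analogue for products, this lets identities about `ι` be checked on unnormalised
  -- fractions, where no gcd intervenes.
  fromℚᵘ-+ : ∀ p q → fromℚᵘ (p ℚᵘ.+ q) ≡ fromℚᵘ p + fromℚᵘ q
  fromℚᵘ-+ p q = toℚᵘ-injective (begin
      toℚᵘ (fromℚᵘ (p ℚᵘ.+ q))                ≈⟨ toℚᵘ-fromℚᵘ (p ℚᵘ.+ q) ⟩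
      p ℚᵘ.+ q                                ≈⟨ ℚᵘ.+-cong (toℚᵘ-fromℚᵘ p) (toℚᵘ-fromℚᵘ q) ⟨
      toℚᵘ (fromℚᵘ p) ℚᵘ.+ toℚᵘ (fromℚᵘ q)    ≈⟨ toℚᵘ-homo-+ (fromℚᵘ p) (fromℚᵘ q) ⟨
      toℚᵘ (fromℚᵘ p + fromℚᵘ q)              ∎)
    where open import Relation.Binary.Reasoning.Setoid ℚᵘ.≃-setoid

  fromℚᵘ-* : ∀ p q → fromℚᵘ (p ℚᵘ.* q) ≡ fromℚᵘ p * fromℚᵘ q
  fromℚᵘ-* p q = toℚᵘ-injective (begin
      toℚᵘ (fromℚᵘ (p ℚᵘ.* q))                ≈⟨ toℚᵘ-fromℚᵘ (p ℚᵘ.* q) ⟩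
      p ℚᵘ.* q                                ≈⟨ ℚᵘ.*-cong (toℚᵘ-fromℚᵘ p) (toℚᵘ-fromℚᵘ q) ⟨
      toℚᵘ (fromℚᵘ p) ℚᵘ.* toℚᵘ (fromℚᵘ q)    ≈⟨ toℚᵘ-homo-* (fromℚᵘ p) (fromℚᵘ q) ⟨
      toℚᵘ (fromℚᵘ p * fromℚᵘ q)              ∎)
    where open import Relation.Binary.Reasoning.Setoid ℚᵘ.≃-setoid

  opaque

    unfolding ι 1/suc

    ι≡ : ∀ n → + n / 1 ≡ ι n
    ι≡ n = refl

    ι-0 : ι 0 ≡ 0ℚ
    ι-0 = refl

    ι-1 : ι 1 ≡ 1ℚ
    ι-1 = refl

    ι-+ : ∀ a b → ι (a ℕ.+ b) ≡ ι a + ι b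
    ι-+ a b = trans
      (fromℚᵘ-cong {mkℚᵘ (+ (a ℕ.+ b)) 0} {mkℚᵘ (+ a) 0 ℚᵘ.+ mkℚᵘ (+ b) 0}
        (*≡* (cong (ℤ._* + 1) (trans (ℤ.pos-+ a b)
        (sym (cong₂ ℤ._+_ (ℤ.*-identityʳ (+ a)) (ℤ.*-identityʳ (+ b))))))))
      (fromℚᵘ-+ (mkℚᵘ (+ a) 0) (mkℚᵘ (+ b) 0))

    ι-* : ∀ a b → ι (a ℕ.* b) ≡ ι a * ι b
    ι-* a b = trans
      (fromℚᵘ-cong {mkℚᵘ (+ (a ℕ.* b)) 0} {mkℚᵘ (+ a) 0 ℚᵘ.* mkℚᵘ (+ b) 0}
        (*≡* (cong (ℤ._* + 1) (ℤ.pos-* a b))))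
      (fromℚᵘ-* (mkℚᵘ (+ a) 0) (mkℚᵘ (+ b) 0))

    ι-*-/ : ∀ p b → ι (suc p) * (+ b / suc p) ≡ ι b
    ι-*-/ p b = trans (sym (fromℚᵘ-* (mkℚᵘ (+ suc p) 0) (mkℚᵘ (+ b) p)))
      (fromℚᵘ-cong {mkℚᵘ (+ suc p) 0 ℚᵘ.* mkℚᵘ (+ b) p} {mkℚᵘ (+ b) 0} (*≡* (begin
        (+ suc p ℤ.* + b) ℤ.* + 1          ≡⟨ ℤ.*-identityʳ _ ⟩
        + suc p ℤ.* + b                    ≡⟨ ℤ.*-comm (+ suc p) (+ b) ⟩
        + b ℤ.* + suc p                    ≡⟨ cong (λ m → + b ℤ.* + m) (ℕ.*-identityˡ (suc p)) ⟨
        + b ℤ.* + (1 ℕ.* suc p)            ∎)))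
      where open ≡-Reasoning

    ι-mono-≤ : ∀ {a b} → a ℕ.≤ b → ι a ≤ ι b
    ι-mono-≤ {a} {b} a≤b = toℚᵘ-cancel-≤ (ℚᵘ.≤-respʳ-≃ (ℚᵘ.≃-sym (toℚᵘ-fromℚᵘ (mkℚᵘ (+ b) 0)))
      (ℚᵘ.≤-respˡ-≃ (ℚᵘ.≃-sym (toℚᵘ-fromℚᵘ (mkℚᵘ (+ a) 0)))
        (*≤* (ℤ.*-monoʳ-≤-nonNeg (+ 1) (ℤ.+≤+ a≤b)))))

    ι-*-1/suc : ∀ n → ι (suc n) * 1/suc n ≡ 1ℚ
    ι-*-1/suc n = ι-*-/ n 1

  0≤ι : ∀ n → 0ℚ ≤ ι n
  0≤ι n = subst (_≤ ι n) ι-0 (ι-mono-≤ ℕ.z≤n)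

  1≤ι : ∀ n → 1ℚ ≤ ι (suc n)
  1≤ι n = subst (_≤ ι (suc n)) ι-1 (ι-mono-≤ (ℕ.s≤s ℕ.z≤n))

  0<ι : ∀ n → 0ℚ < ι (suc n)
  0<ι n = <-≤-trans (positive⁻¹ 1ℚ) (1≤ι n)

  *-monoˡ : ∀ {r p q} → 0ℚ ≤ r → p ≤ q → r * p ≤ r * q
  *-monoˡ {r} 0≤r = *-monoˡ-≤-nonNeg r {{nonNegative 0≤r}}

  *-monoʳ : ∀ {r p q} → 0ℚ ≤ r → p ≤ q → p * r ≤ q * r
  *-monoʳ {r} 0≤r = *-monoʳ-≤-nonNeg r {{nonNegative 0≤r}}

  +-cancelˡ : ∀ r {p q} → r + p ≤ r + q → p ≤ q
  +-cancelˡ r {p} {q} r+p≤r+q = begin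
      p               ≡⟨ cancel r p ⟩
      (r + p) - r     ≤⟨ +-monoˡ-≤ (- r) r+p≤r+q ⟩
      (r + q) - r     ≡⟨ cancel r q ⟨
      q               ∎
    where
    open ≤-Reasoning
    cancel : ∀ r p → p ≡ (r + p) - r
    cancel = solve 2 (λ r p → p := (r :+ p) :- r) refl
      where open +-*-Solver

  p≤∣p∣ : ∀ p → p ≤ ∣ p ∣
  p≤∣p∣ p with ≤-total 0ℚ p
  ... | inj₁ 0≤p = ≤-reflexive (sym (0≤p⇒∣p∣≡p 0≤p))
  ... | inj₂ p≤0 = ≤-trans p≤0 (0≤∣p∣ p)

  ∑ℚ : ∀ {n} → (Fin n → ℚ) → ℚ
  ∑ℚ = foldr _+_ 0ℚ

  ∣∑ℚ∣≤ : ∀ {n} {f g : Fin n → ℚ} → (∀ i → ∣ f i ∣ ≤ g i) → ∣ ∑ℚ f ∣ ≤ ∑ℚ g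
  ∣∑ℚ∣≤ {zero}      h = ≤-refl
  ∣∑ℚ∣≤ {suc n} {f} h =
    ≤-trans (∣p+q∣≤∣p∣+∣q∣ (f zero) _) (+-mono-≤ (h zero) (∣∑ℚ∣≤ (h ∘ suc)))

  ∑ℚ-ι : ∀ {n} M (f : Fin n → ℕ) → ∑ℚ (λ i → M * ι (f i)) ≡ M * ι (∑ (allFin n) f)
  ∑ℚ-ι {zero}  M f = sym (trans (cong (M *_) ι-0) (*-zeroʳ M))
  ∑ℚ-ι {suc n} M f = begin
      M * ι (f zero) + ∑ℚ (λ i → M * ι (f (suc i)))
    ≡⟨ cong (λ s → M * ι (f zero) + s) (∑ℚ-ι M (f ∘ suc)) ⟩
      M * ι (f zero) + M * ι (∑ (allFin n) (f ∘ suc))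
    ≡⟨ *-distribˡ-+ M (ι (f zero)) _ ⟨
      M * (ι (f zero) + ι (∑ (allFin n) (f ∘ suc)))
    ≡⟨ cong (M *_) (ι-+ (f zero) _) ⟨
      M * ι (f zero ℕ.+ ∑ (allFin n) (f ∘ suc))
    ≡⟨ cong (λ s → M * ι s) (∑-allFin-suc f) ⟨
      M * ι (∑ (allFin (suc n)) f)
    ∎
    where open ≡-Reasoning

  maximum : ∀ {n} → Fin n → (f : Fin n → ℚ) → ∃[ i ] (∀ j → f j ≤ f i)
  maximum {n} j f = argmax f j (allFin n)
    , λ i → All.lookup (f[xs]≤f[argmax] {f = f} j (allFin n)) (∈-allFin i)
    where open Data.List.Extrema (DecTotalOrder.totalOrder ≤-decTotalOrder)

  -- If Q d ≤ (C / (1 + m)) d entrywise for a positive weight d, then comparing entries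
  -- where ∣x∣ / d is maximal shows that an approximate eigenvector x for a value
  -- q ≥ C / (1 + m) + ε is small.
  approximate-eigenvector-bound : ∀ {n m C} (Q : Fin n → Fin n → ℕ) (e : Fin n → ℕ) →
    (∀ i → suc m ℕ.* ∑ (allFin n) (λ j → Q i j ℕ.* suc (e j)) ℕ.≤ C ℕ.* suc (e i)) →
    ∀ {q ε η} (x : Fin n → ℚ) → 0ℚ ≤ ε →
    ι C + ι (suc m) * ε ≤ ι (suc m) * q →
    (∀ i → ∣ ∑ℚ (λ j → ι (Q i j) * x j) - q * x i ∣ ≤ η) →
    ∀ j → ε * ∣ x j ∣ ≤ η * ι (suc (e j))
  approximate-eigenvector-bound {n} {m} {C} Q e Qd≤ {q} {ε} {η} x 0≤ε q-large approx j₀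
    with maximum j₀ (λ j → ∣ x j ∣ * 1/suc (e j))
  ... | i , max = begin
      ε * ∣ x j₀ ∣          ≤⟨ *-monoˡ 0≤ε (∣x∣≤ j₀) ⟩
      ε * (M * d j₀)        ≡⟨ *-assoc ε M (d j₀) ⟨
      ε * M * d j₀          ≤⟨ *-monoʳ (0≤d j₀) εM≤η ⟩
      η * d j₀              ∎
    where
    open ≤-Reasoning
    d : Fin n → ℚ
    d j = ι (suc (e j))
    r : Fin n → ℚ
    r j = ∣ x j ∣ * 1/suc (e j)
    M μ S : ℚ
    M = r i
    μ = ι (suc m)
    S = ∑ℚ (λ j → ι (Q i j) * x j)
    swap : ∀ a b c → a * (b * c) ≡ b * (a * c)
    swap = solve 3 (λ a b c → a :* (b :* c) := b :* (a :* c)) refl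
      where open +-*-Solver
    0≤d : ∀ j → 0ℚ ≤ d j
    0≤d j = 0≤ι (suc (e j))
    ∣x∣≡ : ∀ j → ∣ x j ∣ ≡ r j * d j
    ∣x∣≡ j = begin-equality
        ∣ x j ∣                        ≡⟨ *-identityʳ _ ⟨
        ∣ x j ∣ * 1ℚ                   ≡⟨ cong (∣ x j ∣ *_) (ι-*-1/suc (e j)) ⟨
        ∣ x j ∣ * (d j * 1/suc (e j))  ≡⟨ cong (∣ x j ∣ *_) (*-comm (d j) _) ⟩
        ∣ x j ∣ * (1/suc (e j) * d j)  ≡⟨ *-assoc ∣ x j ∣ _ (d j) ⟨
        r j * d j                      ∎
    ∣x∣≤ : ∀ j → ∣ x j ∣ ≤ M * d j
    ∣x∣≤ j = ≤-trans (≤-reflexive (∣x∣≡ j)) (*-monoʳ (0≤d j) (max j))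
    0≤M : 0ℚ ≤ M
    0≤M = *-cancelʳ-≤-pos (d i) {{positive (0<ι (e i))}}
      (subst₂ _≤_ (sym (*-zeroˡ (d i))) (∣x∣≡ i) (0≤∣p∣ (x i)))
    ∣S∣≤ : ∣ S ∣ ≤ M * ι (∑ (allFin n) (λ j → Q i j ℕ.* suc (e j)))
    ∣S∣≤ = ≤-trans (∣∑ℚ∣≤ term) (≤-reflexive (∑ℚ-ι M (λ j → Q i j ℕ.* suc (e j))))
      where
      term : ∀ j → ∣ ι (Q i j) * x j ∣ ≤ M * ι (Q i j ℕ.* suc (e j))
      term j = begin
          ∣ ι (Q i j) * x j ∣       ≡⟨ ∣p*q∣≡∣p∣*∣q∣ (ι (Q i j)) (x j) ⟩
          ∣ ι (Q i j) ∣ * ∣ x j ∣   ≡⟨ cong (_* ∣ x j ∣) (0≤p⇒∣p∣≡p (0≤ι (Q i j))) ⟩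
          ι (Q i j) * ∣ x j ∣       ≤⟨ *-monoˡ (0≤ι (Q i j)) (∣x∣≤ j) ⟩
          ι (Q i j) * (M * d j)     ≡⟨ swap (ι (Q i j)) M (d j) ⟩
          M * (ι (Q i j) * d j)     ≡⟨ cong (M *_) (ι-* (Q i j) (suc (e j))) ⟨
          M * ι (Q i j ℕ.* suc (e j)) ∎
    q∣x∣≤ : q * (M * d i) ≤ ∣ S ∣ + η
    q∣x∣≤ = begin
        q * (M * d i)            ≡⟨ cong (q *_) (∣x∣≡ i) ⟨
        q * ∣ x i ∣              ≤⟨ *-monoʳ (0≤∣p∣ (x i)) (p≤∣p∣ q) ⟩
        ∣ q ∣ * ∣ x i ∣          ≡⟨ ∣p*q∣≡∣p∣*∣q∣ q (x i) ⟨
        ∣ q * x i ∣              ≡⟨ cong ∣_∣ (split S (q * x i)) ⟩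
        ∣ S - (S - q * x i) ∣    ≤⟨ ∣p-q∣≤∣p∣+∣q∣ S (S - q * x i) ⟩
        ∣ S ∣ + ∣ S - q * x i ∣  ≤⟨ +-monoʳ-≤ ∣ S ∣ (approx i) ⟩
        ∣ S ∣ + η                ∎
      where
      split : ∀ a b → b ≡ a - (a - b)
      split = solve 2 (λ a b → b := a :- (a :- b)) refl
        where open +-*-Solver
    μ∣S∣≤ : μ * ∣ S ∣ ≤ ι C * (M * d i)
    μ∣S∣≤ = begin
        μ * ∣ S ∣                    ≤⟨ *-monoˡ (0≤ι (suc m)) ∣S∣≤ ⟩
        μ * (M * ι s)                ≡⟨ swap μ M (ι s) ⟩
        M * (μ * ι s)                ≡⟨ cong (M *_) (ι-* (suc m) s) ⟨
        M * ι (suc m ℕ.* s)          ≤⟨ *-monoˡ 0≤M (ι-mono-≤ (Qd≤ i)) ⟩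
        M * ι (C ℕ.* suc (e i))      ≡⟨ cong (M *_) (ι-* C (suc (e i))) ⟩
        M * (ι C * d i)              ≡⟨ swap M (ι C) (d i) ⟩
        ι C * (M * d i)              ∎
      where
      s : ℕ
      s = ∑ (allFin n) (λ j → Q i j ℕ.* suc (e j))
    0≤Md : 0ℚ ≤ M * d i
    0≤Md = subst (0ℚ ≤_) (∣x∣≡ i) (0≤∣p∣ (x i))
    εMd≤η : ε * (M * d i) ≤ η
    εMd≤η = *-cancelˡ-≤-pos μ {{positive (0<ι m)}} (+-cancelˡ (ι C * (M * d i)) (begin
        ι C * (M * d i) + μ * (ε * (M * d i))  ≡⟨ factor (ι C) μ ε (M * d i) ⟩
        (ι C + μ * ε) * (M * d i)              ≤⟨ *-monoʳ 0≤Md q-large ⟩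
        μ * q * (M * d i)                      ≡⟨ *-assoc μ q (M * d i) ⟩
        μ * (q * (M * d i))                    ≤⟨ *-monoˡ (0≤ι (suc m)) q∣x∣≤ ⟩
        μ * (∣ S ∣ + η)                        ≡⟨ *-distribˡ-+ μ ∣ S ∣ η ⟩
        μ * ∣ S ∣ + μ * η                      ≤⟨ +-monoˡ-≤ (μ * η) μ∣S∣≤ ⟩
        ι C * (M * d i) + μ * η                ∎))
      where
      factor : ∀ c μ ε w → c * w + μ * (ε * w) ≡ (c + μ * ε) * w
      factor = solve 4 (λ c μ ε w → c :* w :+ μ :* (ε :* w) := (c :+ μ :* ε) :* w) refl
        where open +-*-Solver
    εM≤η : ε * M ≤ η
    εM≤η = begin
        ε * M           ≡⟨ cong (ε *_) (*-identityʳ M) ⟨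
        ε * (M * 1ℚ)    ≤⟨ *-monoˡ 0≤ε (*-monoˡ 0≤M (1≤ι (e i))) ⟩
        ε * (M * d i)   ≤⟨ εMd≤η ⟩
        η               ∎

-- Passage to real eigenvalues, the order bound and the conclusion.

module Spectral where

  open import Data.Fin using (Fin; zero; suc)
  open import Data.Integer as ℤ using (+_)
  import Data.Integer.Properties as ℤ
  open import Data.List using (allFin)
  open import Data.Nat
  open import Data.Nat.Divisibility using (_∣_)
  open import Data.Nat.Properties
  open import Data.Nat.Tactic.RingSolver using (solve-∀)
  open import Data.Product using (∃-syntax; _×_; _,_; proj₁; proj₂)
  open import Data.Rational as ℚ using (ℚ; 0ℚ; 1ℚ; ½)
  import Data.Rational.Properties as ℚ
  open import Function using (_∘_)
  open import Relation.Binary.PropositionalEquality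
  open import Relation.Nullary using (¬_)
  open Sums
  open Combinatorics
  open Rationals
  open DegreeSums

  -- Comparing entries by size requires all coordinates to be accurate at the same index; finitely
  -- many thresholds have a maximum.
  eventually-∀ : ∀ {n} {P : Fin n → ℕ → Set} →
    (∀ i → Eventually (P i)) → Eventually (λ N → ∀ i → P i N)
  eventually-∀ {zero}  h = 0 , λ _ _ ()
  eventually-∀ {suc n} h with h zero | eventually-∀ (h ∘ suc)
  ... | M , p | M′ , p′ = M ⊔ M′ , λ
    { N ≤N zero    → p N (m⊔n≤o⇒m≤o M M′ ≤N)
    ; N ≤N (suc i) → p′ N (m⊔n≤o⇒n≤o M M′ ≤N) i }

  seq-sumᴿ : ∀ {n} (f : Fin n → ℝ) N {g : Fin n → ℚ} → (∀ j → seq (f j) N ≡ g j) →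
    seq (sumᴿ f) N ≡ ∑ℚ g
  seq-sumᴿ {zero}  f N h = refl
  seq-sumᴿ {suc n} f N h = cong₂ ℚ._+_ (h zero) (seq-sumᴿ (f ∘ suc) N (h ∘ suc))

  opaque

    unfolding ι

    seq-fromℕ-* : ∀ a y N → seq (fromℕ a *ᴿ y) N ≡ ι a ℚ.* seq y N
    seq-fromℕ-* a y N = refl

  half< : ∀ {p} → 0ℚ ℚ.< p → ½ ℚ.* p ℚ.< p
  half< {p} 0<p = subst₂ ℚ._<_ (ℚ.+-identityʳ (½ ℚ.* p)) (half+half p)
    (ℚ.+-monoʳ-< (½ ℚ.* p) (half-pos 0<p))

  -- At each late index the approximations to x form a rational approximate eigenvector, so
  -- `approximate-eigenvector-bound` applies there and forces every coordinate to tend to 0.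
  eigenvalue-bound : ∀ {n m C} (Q : Matrix ℕ n) (e : Fin n → ℕ) →
    (∀ i → suc m * ∑ (allFin n) (λ j → Q i j * suc (e j)) ≤ C * suc (e i)) →
    ∀ q {ε} → 0ℚ ℚ.< ε →
    Eventually (λ N → ι C ℚ.+ ι (suc m) ℚ.* ε ℚ.≤ ι (suc m) ℚ.* seq q N) →
    ¬ IsEigenvalue (λ u v → fromℕ (Q u v)) q
  eigenvalue-bound {n} Q e Qd≤ q {ε} 0<ε (N₀ , q-large) (x , x≉0 , Qx≈qx) = x≉0 x≈0
    where
    Close : ℚ → Fin n → ℕ → Set
    Close η i N = ℚ.∣ ∑ℚ (λ l → ι (Q i l) ℚ.* seq (x l) N) ℚ.- seq q N ℚ.* seq (x i) N ∣ ℚ.≤ η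
    Qx-close : ∀ η → 0ℚ ℚ.< η → ∀ i → Eventually (Close η i)
    Qx-close η 0<η i = proj₁ close , λ N ≤N → subst
      (λ s → ℚ.∣ s ℚ.- seq q N ℚ.* seq (x i) N ∣ ℚ.≤ η)
      (seq-sumᴿ (λ l → fromℕ (Q i l) *ᴿ x l) N (λ l → seq-fromℕ-* (Q i l) (x l) N))
      (ℚ.<⇒≤ (proj₂ close N ≤N))
      where close = Qx≈qx i η 0<η
    module _ (i : Fin n) {ζ η} (0<ζ : 0ℚ ℚ.< ζ)
      (dη≡ : ι (suc (e i)) ℚ.* η ≡ ε ℚ.* (½ ℚ.* ζ)) where

      open ℚ.≤-Reasoning

      scaled : ∀ N → N₀ ≤ N → (∀ i → Close η i N) →
        ε ℚ.* ℚ.∣ seq (x i) N ∣ ℚ.≤ ε ℚ.* (½ ℚ.* ζ)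
      scaled N ≤N close = begin
          ε ℚ.* ℚ.∣ seq (x i) N ∣
        ≤⟨ approximate-eigenvector-bound Q e Qd≤ {seq q N} {ε} {η} (λ j → seq (x j) N)
             (ℚ.<⇒≤ 0<ε) (q-large N ≤N) close i ⟩
          η ℚ.* ι (suc (e i))
        ≡⟨ ℚ.*-comm η (ι (suc (e i))) ⟩
          ι (suc (e i)) ℚ.* η
        ≡⟨ dη≡ ⟩
          ε ℚ.* (½ ℚ.* ζ)
        ∎

      small : ∀ N → N₀ ≤ N → (∀ i → Close η i N) → ℚ.∣ seq (x i) N ℚ.- 0ℚ ∣ ℚ.< ζ
      small N ≤N close = begin-strict
          ℚ.∣ seq (x i) N ℚ.- 0ℚ ∣
        ≡⟨ cong ℚ.∣_∣ (ℚ.+-identityʳ (seq (x i) N)) ⟩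
          ℚ.∣ seq (x i) N ∣
        ≤⟨ ℚ.*-cancelˡ-≤-pos ε {{ℚ.positive 0<ε}} (scaled N ≤N close) ⟩
          ½ ℚ.* ζ
        <⟨ half< 0<ζ ⟩
          ζ
        ∎

    x≈0 : ∀ i → x i ≈ᴿ 0ᴿ
    x≈0 i ζ 0<ζ =
      -- The estimate is ε |x_i| ≤ η d_i, so η is chosen with d_i η = ε ζ / 2; this yields |x_i| ≤ ζ
      -- / 2, strictly below ζ.
      let η , 0<η , dη≡ = divide (0<ι (e i)) (subst (ℚ._< ε ℚ.* (½ ℚ.* ζ)) (ℚ.*-zeroʳ ε)
                            (ℚ.*-monoʳ-<-pos ε {{ℚ.positive 0<ε}} (half-pos 0<ζ)))
          N₁ , close = eventually-∀ {P = Close η} (Qx-close η 0<η)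
      in N₀ ⊔ N₁ , λ N ≤N → small i 0<ζ dη≡ N
           (m⊔n≤o⇒m≤o N₀ N₁ ≤N) (close N (m⊔n≤o⇒n≤o N₀ N₁ ≤N))

  -- If 2e ≤ (n - 1)(n - 2) + B, the weighted row bound n - 2 + 2e / (n - 1) is at most 2 (n - 2) +
  -- B / (n - 1). For B = 2k - 2 this is the value in the theorem.
  spectral-radius-bound : ∀ {p B} (G : Graph (suc (suc p))) → (∀ v → 1 ≤ degree G v) →
    ∑ (allFin (suc (suc p))) (degree G) ≤ suc p * p + B → ∀ q {ε} → 0ℚ ℚ.< ε →
    Eventually (λ N → ι (2 * (suc p * p) + B) ℚ.+ ι (suc p) ℚ.* ε ℚ.≤ ι (suc p) ℚ.* seq q N) →
    ¬ IsEigenvalue (λ u v → fromℕ (signlessLaplacian G u v)) q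
  spectral-radius-bound {p} {B} G 1≤degree D≤ =
    -- The weight is the degree; `eigenvalue-bound` takes weights in the form `suc (e i)`, hence the
    -- predecessor.
    eigenvalue-bound (signlessLaplacian G) (pred ∘ d) λ v → begin
      m * ∑ V (λ u → signlessLaplacian G v u * suc (pred (d u)))
    ≡⟨ cong (m *_) (∑-cong V (λ u → cong (signlessLaplacian G v u *_) (suc-pred-d u))) ⟩
      m * ∑ V (λ u → signlessLaplacian G v u * d u)
    ≡⟨ cong (m *_) (Q-row G 1≤degree v) ⟩
      m * (d v * d v + ∑ V (λ u → A G v u * d u))
    ≤⟨ weighted-row-bound G 1≤degree v ⟩
      (m * p + D) * d v
    ≤⟨ *-monoˡ-≤ (d v) (+-monoʳ-≤ (m * p) D≤) ⟩
      (m * p + (m * p + B)) * d v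
    ≡⟨ cong₂ _*_ (rearrange (m * p) B) (sym (suc-pred-d v)) ⟩
      (2 * (m * p) + B) * suc (pred (d v))
    ∎
    where
    open ≤-Reasoning
    V = allFin (suc (suc p))
    d = degree G
    D = ∑ V d
    m = suc p
    suc-pred-d : ∀ u → suc (pred (d u)) ≡ d u
    suc-pred-d u = suc-pred (d u) {{>-nonZero (1≤degree u)}}
    rearrange : ∀ a b → a + (a + b) ≡ 2 * a + b
    rearrange = solve-∀

  -- The relation `_<ᴿ_` with a constant rational on the left, restated so that this rational can
  -- stay opaque.
  Exceeds : ℚ → ℝ → Set
  Exceeds b q = ∃[ ε ] (0ℚ ℚ.< ε × Eventually (λ N → b ℚ.+ ε ℚ.≤ seq q N))

  opaque

    threshold : ℕ → ℕ → ℚ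
    threshold k n = ((+ 2 ℤ.* (+ n ℤ.- + 2)) ℚ./ 1) ℚ.+ ((+ 2 ℤ.* + k ℤ.- + 2) /₀ (n ∸ 1))

    exceeds-threshold : ∀ {k n} q →
      fromℤ (+ 2 ℤ.* (+ n ℤ.- + 2)) +ᴿ fromℚ ((+ 2 ℤ.* + k ℤ.- + 2) /₀ (n ∸ 1)) <ᴿ q →
      Exceeds (threshold k n) q
    exceeds-threshold q h = h

    -- Writing k = j + 1 and n = p + 2 removes the integer subtractions and keeps `_/₀_` away from
    -- its junk value.
    threshold≡ : ∀ j p → threshold (suc j) (suc (suc p)) ≡ ι (2 * p) ℚ.+ (+ (2 * j) ℚ./ suc p)
    threshold≡ j p = trans
      (cong₂ (λ a b → (a ℚ./ 1) ℚ.+ (b ℚ./ suc p))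
         (sym (ℤ.pos-* 2 p)) (cong (λ a → + a ℤ.- + 2) (*-suc 2 j)))
      (cong (λ a → a ℚ.+ (+ (2 * j) ℚ./ suc p)) (ι≡ (2 * p)))

  n-1*threshold : ∀ j p →
    ι (suc p) ℚ.* threshold (suc j) (suc (suc p)) ≡ ι (2 * (suc p * p) + 2 * j)
  n-1*threshold j p = begin
      ι (suc p) ℚ.* threshold (suc j) (suc (suc p))
    ≡⟨ cong (ι (suc p) ℚ.*_) (threshold≡ j p) ⟩
      ι (suc p) ℚ.* (ι (2 * p) ℚ.+ (+ (2 * j) ℚ./ suc p))
    ≡⟨ ℚ.*-distribˡ-+ (ι (suc p)) (ι (2 * p)) _ ⟩
      ι (suc p) ℚ.* ι (2 * p) ℚ.+ ι (suc p) ℚ.* (+ (2 * j) ℚ./ suc p)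
    ≡⟨ cong₂ ℚ._+_ (sym (ι-* (suc p) (2 * p))) (ι-*-/ p (2 * j)) ⟩
      ι (suc p * (2 * p)) ℚ.+ ι (2 * j)
    ≡⟨ ι-+ (suc p * (2 * p)) (2 * j) ⟨
      ι (suc p * (2 * p) + 2 * j)
    ≡⟨ cong (λ a → ι (a + 2 * j)) (rearrange (suc p) p) ⟩
      ι (2 * (suc p * p) + 2 * j)
    ∎
    where
    open ≡-Reasoning
    rearrange : ∀ a b → a * (2 * b) ≡ 2 * (a * b)
    rearrange = solve-∀

  -- Here κ, σ, ν stand for k, an approximation to the square root, and n. The left side is at least
  -- (4 + 3 - 1) / 2 = 3, the right side at most 3/2, and 2 lies between.
  small-order-absurd : ∀ {κ σ ν} → + 2 ℚ./ 1 ℚ.≤ κ → 0ℚ ℚ.≤ σ ℚ.+ 1ℚ → ν ℚ.≤ 1ℚ →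
    ¬ ½ ℚ.* ((+ 2 ℚ./ 1) ℚ.* κ ℚ.+ (+ 3 ℚ./ 1) ℚ.+ σ) ℚ.≤ ν ℚ.+ ½
  small-order-absurd {κ} {σ} {ν} 2≤κ 0≤σ+1 ν≤1 bound = ℚ.<-irrefl refl (begin-strict
      + 2 ℚ./ 1
    <⟨ ℚ.*<* (ℤ.+<+ (s≤s (s≤s (s≤s z≤n)))) ⟩
      ½ ℚ.* ((+ 2 ℚ./ 1) ℚ.* (+ 2 ℚ./ 1) ℚ.+ (+ 2 ℚ./ 1) ℚ.+ 0ℚ)
    ≤⟨ ℚ.*-monoˡ-≤-nonNeg ½ (ℚ.+-mono-≤ (ℚ.+-monoˡ-≤ (+ 2 ℚ./ 1)
         (ℚ.*-monoˡ-≤-nonNeg (+ 2 ℚ./ 1) 2≤κ)) 0≤σ+1) ⟩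
      ½ ℚ.* ((+ 2 ℚ./ 1) ℚ.* κ ℚ.+ (+ 2 ℚ./ 1) ℚ.+ (σ ℚ.+ 1ℚ))
    ≡⟨ cong (½ ℚ.*_) (rearrange ((+ 2 ℚ./ 1) ℚ.* κ) σ) ⟩
      ½ ℚ.* ((+ 2 ℚ./ 1) ℚ.* κ ℚ.+ (+ 3 ℚ./ 1) ℚ.+ σ)
    ≤⟨ bound ⟩
      ν ℚ.+ ½
    ≤⟨ ℚ.+-monoˡ-≤ ½ ν≤1 ⟩
      1ℚ ℚ.+ ½
    <⟨ ℚ.*<* (ℤ.+<+ (s≤s (s≤s (s≤s (s≤s z≤n))))) ⟩
      + 2 ℚ./ 1
    ∎)
    where
    open ℚ.≤-Reasoning
    open import Data.Rational.Solver using (module +-*-Solver)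
    rearrange : ∀ a b → a ℚ.+ (+ 2 ℚ./ 1) ℚ.+ (b ℚ.+ 1ℚ) ≡ a ℚ.+ (+ 3 ℚ./ 1) ℚ.+ b
    rearrange = solve 2 (λ a b → a :+ con (+ 2 ℚ./ 1) :+ (b :+ con 1ℚ)
                                := a :+ con (+ 3 ℚ./ 1) :+ b) refl
      where open +-*-Solver

  -- For k at least 2 and s nonnegative the bound on n is at least 7/2, far enough from 1 that the
  -- comparisons of reals may be read with the crude errors 1 and ½.
  order≥2 : ∀ {k n} → 2 ≤ k → ∀ s → 0ᴿ ≤ᴿ s →
    fromℚ ½ *ᴿ (fromℕ 2 *ᴿ fromℕ k +ᴿ fromℕ 3 +ᴿ s) ≤ᴿ fromℕ n → 2 ≤ n
  order≥2 {k} {n} 2≤k s 0≤s bound with 0≤s 1ℚ (ℚ.positive⁻¹ 1ℚ) | bound ½ (ℚ.positive⁻¹ ½)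
  ... | N₁ , h₁ | N₂ , h₂ = ≰⇒> λ n≤1 → small-order-absurd
    (subst₂ ℚ._≤_ (sym (ι≡ 2)) (sym (ι≡ k)) (ι-mono-≤ 2≤k))
    (h₁ (N₁ ⊔ N₂) (m≤m⊔n N₁ N₂))
    (subst₂ ℚ._≤_ (sym (ι≡ n)) ι-1 (ι-mono-≤ n≤1))
    (h₂ (N₁ ⊔ N₂) (m≤n⊔m N₁ N₂))

  -- Contrapositive of `spectral-radius-bound`; it is available constructively because the
  -- conclusion compares natural numbers.
  many-edges : ∀ {p B b} (G : Graph (suc (suc p))) → Connected G →
    ∀ q → IsEigenvalue (λ u v → fromℕ (signlessLaplacian G u v)) q →
    ι (suc p) ℚ.* b ≡ ι (2 * (suc p * p) + B) → Exceeds b q →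
    suc p * p + B < ∑ (allFin (suc (suc p))) (degree G)
  many-edges {p} {B} {b} G connected q eigen b≡ (ε , 0<ε , N₀ , q-large) = ≰⇒> λ D≤ →
    spectral-radius-bound G (connected⇒1≤degree G connected) D≤ q 0<ε
      (N₀ , λ N ≤N → begin
        ι (2 * (suc p * p) + B) ℚ.+ ι (suc p) ℚ.* ε
      ≡⟨ cong (ℚ._+ ι (suc p) ℚ.* ε) b≡ ⟨
        ι (suc p) ℚ.* b ℚ.+ ι (suc p) ℚ.* ε
      ≡⟨ ℚ.*-distribˡ-+ (ι (suc p)) b ε ⟨
        ι (suc p) ℚ.* (b ℚ.+ ε)
      ≤⟨ *-monoˡ (0≤ι (suc p)) (q-large N ≤N) ⟩
        ι (suc p) ℚ.* seq q N
      ∎) eigen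
    where open ℚ.≤-Reasoning

  strongParity-of-spectral-radius : ∀ {k n} → 2 ≤ k → 2 ∣ k → 2 ≤ n →
    (G : Graph n) → Connected G →
    ∀ q → IsEigenvalue (λ u v → fromℕ (signlessLaplacian G u v)) q →
    Exceeds (threshold k n) q → StrongParityProperty k G
  strongParity-of-spectral-radius {suc j} {suc (suc p)} (s≤s _) 2∣k (s≤s (s≤s _))
    G connected q eigen q> =
    strongParity (suc j) G (s≤s z≤n) 2∣k (dense G
      (many-edges {B = 2 * j} {b = threshold (suc j) (suc (suc p))}
        G connected q eigen (n-1*threshold j p) q>))

open import Data.Integer using (+_; _+_; _-_; _*_)
open import Data.Nat using (ℕ; _≤_; _∸_)
open import Data.Nat.Divisibility using (_∣_)
open import Data.Product using (_,_)
open import Data.Rational using (½)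
open Spectral using (order≥2; exceeds-threshold; strongParity-of-spectral-radius)

theorem1p3 : ∀ (k : ℕ) → 2 ≤ k → 2 ∣ k →
    ∀ (n : ℕ) (G : Graph n) → Connected G →
    ∀ (s : ℝ) → IsSqrt (fromℤ (+ 8 * (+ k * + k) - + 8 * + k + + 1)) s →
    fromℚ ½ *ᴿ (fromℕ 2 *ᴿ fromℕ k +ᴿ fromℕ 3 +ᴿ s) ≤ᴿ fromℕ n →
    ∀ (q : ℝ) → IsSignlessLaplacianSpectralRadius G q →
    fromℤ (+ 2 * (+ n - + 2)) +ᴿ fromℚ ((+ 2 * + k - + 2) /₀ (n ∸ 1)) <ᴿ q →
    StrongParityProperty k G
theorem1p3 k 2≤k 2∣k n G connected s (0≤s , _) bound q (eigen , _) q> =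
  strongParity-of-spectral-radius 2≤k 2∣k (order≥2 2≤k s 0≤s bound) G connected q eigen
    (exceeds-threshold {k} {n} q q>)
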